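{- Let $w \in \mathfrak{S}_n$ with $n\ge 1$. Then: (i) $\mathrm{dp}(w) = \ell_S(w)$ if and only if $w$ avoids the pattern $321$; and (ii) $\ell_T(w) = \mathrm{dp}(w)$ if and only if $w$ avoids both of the patterns $321$ and $3412$. In particular, the number of $w\in\mathfrak{S}_n$ with $\mathrm{dp}(w) = \ell_S(w)$ is the Catalan number $\frac{1}{n+1}\binom{2n}{n}$, and the number of $w\in\mathfrak{S}_n$ with $\ell_T(w) = \mathrm{dp}(w)$ is the Fibonacci number $F_{2n-1}$.
   Context: $\mathfrak{S}_n$ is the group of permutations of $\{1,\dots,n\}$. For $1\le i<j\le n$, $t_{ij}$ denotes the transposition interchanging $i$ and $j$; its depth is $j-i$. The length $\ell_S(w)$ is the minimal number of factors in an expression of $w$ as a product of adjacent transpositions $s_i=t_{i,i+1}$; the reflection length $\ell_T(w)$ is the minimal number of factors in an expression of $w$ as a product of arbitrary transpositions. The depth of $w$ is $$\mathrm{dp}(w)=\min\Big\{\sum_{r=1}^k (j_r-i_r) : k\ge 0,\ w=t_{i_1j_1}\cdots t_{i_kj_k},\ i_r<j_r\Big\}.$$ For $p\in\mathfrak{S}_k$, the permutation $w$ contains the pattern $p$ if there are indices $i_1<\cdots<i_k$ such that $w(i_1)\cdots w(i_k)$ is in the same relative order as $p(1)\cdots p(k)$; otherwise $w$ avoids $p$. The Fibonacci numbers are $F_0=0$, $F_1=1$, $F_{m}=F_{m-1}+F_{m-2}$. -}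

module Defs where

open import Data.Fin.Base using (Fin; suc; toℕ; _<_)
open import Data.Fin.Patterns using (0F; 1F; 2F; 3F)
import Data.Fin.Properties as Finₚ
open import Data.Fin.Permutation as Perm
  using (Permutation′; permutation; _⟨$⟩ʳ_; _⟨$⟩ˡ_; _≈_; _∘ₚ_; flip; remove)
open import Data.Fin.Permutation.Transposition.List
  using (TranspositionList; eval; lift₀; eval-lift)
open import Data.List.Base
  using (List; []; _∷_; _++_; length; map; filter; cartesianProductWith;
         cartesianProduct; allFin)
open import Data.List.Extrema.Nat using (argmin; argmin-all; f[argmin]≤f[⊤]; f[argmin]≤f[xs])
open import Data.List.Membership.Propositional using (_∈_)
open import Data.List.Membership.Propositional.Properties
  using (∈-filter⁺; ∈-cartesianProduct⁺; ∈-cartesianProductWith⁺; ∈-allFin)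
open import Data.List.Relation.Unary.All as All using (All; []; _∷_)
import Data.List.Relation.Unary.All.Properties as Allₚ
open import Data.List.Relation.Unary.Any using (here; there)
open import Data.Nat.Base using (ℕ; zero; suc; _+_; _*_; _∸_; _/_; _≤_; s≤s; z≤n; _!)
open import Data.Nat.Combinatorics using (_C_; nCk≡n!/k![n-k]!; k![n∸k]!∣n!)
open import Data.Nat.Coprimality using (Coprime; coprime-divisor)
open import Data.Nat.Divisibility using (_∣_; ∣m+n∣m⇒∣n; ∣1⇒≡1; n∣m*n; ∣-refl)
open import Data.Nat.DivMod using (m/n*n≡m)
open import Data.Nat.ListAction using (sum)
import Data.Nat.Properties as ℕₚ
open import Data.Nat.Tactic.RingSolver using (solve-∀)
open import Data.Product.Base using (Σ; ∃; _×_; _,_; proj₁; proj₂)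
open import Data.Vec.Base using (Vec; []; _∷_; lookup)
open import Function.Base using (_∘_)
open import Function.Bundles using (Inverse; _⇔_)
open import Level using (0ℓ)
open import Relation.Binary.Bundles using (Setoid)
import Relation.Binary.Construct.On as On
open import Relation.Binary.PropositionalEquality
  using (_≡_; refl; sym; trans; cong; subst; setoid; _→-setoid_; module ≡-Reasoning)
open import Relation.Nullary.Decidable using (yes; no; _×-dec_)
open import Relation.Nullary.Negation using (¬_)
open import Relation.Unary using (Pred; Decidable)

private
  variable
    n k : ℕ

-- Positions and values are numbered 0, …, n-1, so t_{ij} is the pair (i-1 , j-1).
-- `eval` multiplies a word with its leftmost letter acting first; the opposite convention
-- reverses words, which changes neither of the weights minimised below.

IsTransposition : Fin n × Fin n → Set
IsTransposition (i , j) = i < j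

IsAdjacent : Fin n × Fin n → Set
IsAdjacent (i , j) = toℕ j ≡ suc (toℕ i)

depth : Fin n × Fin n → ℕ
depth (i , j) = toℕ j ∸ toℕ i

TotalDepth : TranspositionList n → ℕ
TotalDepth = sum ∘ map depth

FactorisationInto : (Fin n × Fin n → Set) → Permutation′ n → Pred (TranspositionList n) 0ℓ
FactorisationInto A w ts = All A ts × eval ts ≈ w

IsMinimum : {X : Set} → (X → ℕ) → Pred X 0ℓ → ℕ → Set
IsMinimum f P m = (∃ λ x → P x × f x ≡ m) × (∀ x → P x → m ≤ f x)

private

  words≤ : ℕ → List (TranspositionList n)
  words≤ zero = [] ∷ []
  words≤ {n} (suc m) =
    [] ∷ cartesianProductWith _∷_ (cartesianProduct (allFin n) (allFin n)) (words≤ m)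

  ∈-words≤ : ∀ {m} (ts : TranspositionList n) → length ts ≤ m → ts ∈ words≤ m
  ∈-words≤ {m = zero}  []             _       = here refl
  ∈-words≤ {m = suc m} []             _       = here refl
  ∈-words≤ {m = suc m} ((i , j) ∷ ts) (s≤s l) =
    there
      (∈-cartesianProductWith⁺ _∷_ (∈-cartesianProduct⁺ (∈-allFin i) (∈-allFin j)) (∈-words≤ ts l))

  minimum : (f : TranspositionList n → ℕ) {P : Pred (TranspositionList n) 0ℓ} → Decidable P →
            (∀ ts → P ts → length ts ≤ f ts) → ∃ P → ∃ (IsMinimum f P)
  minimum f {P} P? short (t₀ , p₀) =
    f best , (best , argmin-all f p₀ (Allₚ.all-filter P? (words≤ (f t₀))) , refl) , least
    where
    candidates = filter P? (words≤ (f t₀))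
    best = argmin f t₀ candidates

    least : ∀ ts → P ts → f best ≤ f ts
    least ts p with f ts ℕₚ.≤? f t₀
    ... | yes le = All.lookup (f[argmin]≤f[xs] {f = f} t₀ candidates)
                     (∈-filter⁺ P? (∈-words≤ ts (ℕₚ.≤-trans (short ts p) le)) p)
    ... | no ¬le = ℕₚ.≤-trans (f[argmin]≤f[⊤] {f = f} t₀ candidates) (ℕₚ.<⇒≤ (ℕₚ.≰⇒> ¬le))

  factorisation? : {A : Fin n × Fin n → Set} → Decidable A →
                   ∀ w → Decidable (FactorisationInto A w)
  factorisation? A? w ts =
    All.all? A? ts ×-dec Finₚ.all? (λ i → (eval ts ⟨$⟩ʳ i) Finₚ.≟ (w ⟨$⟩ʳ i))

  isTransposition? : Decidable (IsTransposition {n})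
  isTransposition? (i , j) = i Finₚ.<? j

  isAdjacent? : Decidable (IsAdjacent {n})
  isAdjacent? (i , j) = toℕ j ℕₚ.≟ suc (toℕ i)

  length≤TotalDepth : (ts : TranspositionList n) → All IsTransposition ts →
                      length ts ≤ TotalDepth ts
  length≤TotalDepth []       []       = z≤n
  length≤TotalDepth (t ∷ ts) (p ∷ ps) = ℕₚ.+-mono-≤ (ℕₚ.m<n⇒0<n∸m p) (length≤TotalDepth ts ps)

  eval-++ : (ss ts : TranspositionList n) → eval (ss ++ ts) ≈ eval ss ∘ₚ eval ts
  eval-++ []             ts x = refl
  eval-++ ((i , j) ∷ ss) ts x = eval-++ ss ts _

  lift₀-adjacent : {ts : TranspositionList n} → All IsAdjacent ts → All IsAdjacent (lift₀ ts)
  lift₀-adjacent []       = []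
  lift₀-adjacent (p ∷ ps) = cong suc p ∷ lift₀-adjacent ps

  toFront : (i : Fin (suc n)) →
            ∃ λ (ts : TranspositionList (suc n)) → All IsAdjacent ts × eval ts ⟨$⟩ʳ i ≡ 0F
  toFront 0F = [] , [] , refl
  toFront {suc n} (suc i) with toFront i
  ... | ts , adj , eq =
    lift₀ ts ++ (0F , 1F) ∷ [] ,
    Allₚ.++⁺ (lift₀-adjacent adj) (refl ∷ []) ,
    trans (eval-++ (lift₀ ts) _ (suc i))
      (cong (Perm.transpose 0F 1F ⟨$⟩ʳ_) (trans (eval-lift ts (suc i)) (cong suc eq)))

  adjacentFactorisation : (w : Permutation′ n) → ∃ (FactorisationInto IsAdjacent w)
  adjacentFactorisation {zero}  w = [] , [] , λ ()
  adjacentFactorisation {suc n} w with toFront (w ⟨$⟩ˡ 0F)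
  ... | ts , adj , eq = let us , adj′ , eq′ = adjacentFactorisation (remove 0F v) in
    ts ++ lift₀ us , Allₚ.++⁺ adj (lift₀-adjacent adj′) , λ x →
      begin
        eval (ts ++ lift₀ us) ⟨$⟩ʳ x
          ≡⟨ eval-++ ts (lift₀ us) x ⟩
        eval (lift₀ us) ⟨$⟩ʳ (eval ts ⟨$⟩ʳ x)
          ≡⟨ eval-lift us (eval ts ⟨$⟩ʳ x) ⟩
        Perm.lift₀ (eval us) ⟨$⟩ʳ (eval ts ⟨$⟩ʳ x)
          ≡⟨ Perm.lift₀-cong (eval us) (remove 0F v) eq′ (eval ts ⟨$⟩ʳ x) ⟩
        Perm.lift₀ (remove 0F v) ⟨$⟩ʳ (eval ts ⟨$⟩ʳ x)
          ≡⟨ Perm.lift₀-remove v v0 (eval ts ⟨$⟩ʳ x) ⟩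
        v ⟨$⟩ʳ (eval ts ⟨$⟩ʳ x)
          ≡⟨ cong (w ⟨$⟩ʳ_) (Perm.inverseˡ (eval ts)) ⟩
        w ⟨$⟩ʳ x ∎
    where
    open ≡-Reasoning
    v = flip (eval ts) ∘ₚ w
    v0 : v ⟨$⟩ʳ 0F ≡ 0F
    v0 = trans (cong (λ y → w ⟨$⟩ʳ (eval ts ⟨$⟩ˡ y)) (sym eq))
           (trans (cong (w ⟨$⟩ʳ_) (Perm.inverseˡ (eval ts))) (Perm.inverseʳ w))

  factorisation : (w : Permutation′ n) → ∃ (FactorisationInto IsTransposition w)
  factorisation w with adjacentFactorisation w
  ... | ts , adj , eq = ts , All.map (ℕₚ.≤-reflexive ∘ sym) adj , eq

-- Opaque only to keep type checking cheap; the `isMinimum` lemmas determine the values.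
opaque

  minimum-ℓS : (w : Permutation′ n) → ∃ (IsMinimum length (FactorisationInto IsAdjacent w))
  minimum-ℓS w = minimum length (factorisation? isAdjacent? w)
    (λ _ _ → ℕₚ.≤-refl) (adjacentFactorisation w)

  minimum-ℓT : (w : Permutation′ n) → ∃ (IsMinimum length (FactorisationInto IsTransposition w))
  minimum-ℓT w = minimum length (factorisation? isTransposition? w)
    (λ _ _ → ℕₚ.≤-refl) (factorisation w)

  minimum-dp : (w : Permutation′ n) → ∃ (IsMinimum TotalDepth (FactorisationInto IsTransposition w))
  minimum-dp w = minimum TotalDepth (factorisation? isTransposition? w)
    (λ ts p → length≤TotalDepth ts (proj₁ p)) (factorisation w)

ℓS ℓT dp : Permutation′ n → ℕ
ℓS w = proj₁ (minimum-ℓS w)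
ℓT w = proj₁ (minimum-ℓT w)
dp w = proj₁ (minimum-dp w)

isMinimum-ℓS : (w : Permutation′ n) → IsMinimum length (FactorisationInto IsAdjacent w) (ℓS w)
isMinimum-ℓS w = proj₂ (minimum-ℓS w)

isMinimum-ℓT : (w : Permutation′ n) → IsMinimum length (FactorisationInto IsTransposition w) (ℓT w)
isMinimum-ℓT w = proj₂ (minimum-ℓT w)

isMinimum-dp : (w : Permutation′ n) → IsMinimum TotalDepth (FactorisationInto IsTransposition w) (dp w)
isMinimum-dp w = proj₂ (minimum-dp w)

Contains : Permutation′ n → Permutation′ k → Set
Contains {n} {k} w p = ∃ λ (i : Fin k → Fin n) →
  (∀ a b → a < b → i a < i b) ×
  (∀ a b → (w ⟨$⟩ʳ i a) < (w ⟨$⟩ʳ i b) ⇔ (p ⟨$⟩ʳ a) < (p ⟨$⟩ʳ b))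

Avoids : Permutation′ n → Permutation′ k → Set
Avoids w p = ¬ Contains w p

-- One-line notation, with values shifted down by one.
involution : (ps : Vec (Fin k) k) → (∀ i → lookup ps (lookup ps i) ≡ i) → Permutation′ k
involution ps inv = permutation (lookup ps) (lookup ps) inv inv

p321 : Permutation′ 3
p321 = involution (2F ∷ 1F ∷ 0F ∷ []) λ { 0F → refl ; 1F → refl ; 2F → refl }

p3412 : Permutation′ 4
p3412 = involution (2F ∷ 3F ∷ 0F ∷ 1F ∷ []) λ { 0F → refl ; 1F → refl ; 2F → refl ; 3F → refl }

-- Permutations are compared as functions, ignoring their inverses' representations
-- and the proofs of the predicate.
PermutationsWith : Pred (Permutation′ n) 0ℓ → Setoid 0ℓ 0ℓ
PermutationsWith {n} P = On.setoid {B = Σ (Permutation′ n) P} (Fin n →-setoid Fin n)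
  (λ (w , _) → w ⟨$⟩ʳ_)

HasCardinality : Setoid 0ℓ 0ℓ → ℕ → Set
HasCardinality S c = Inverse S (setoid (Fin c))

fibonacci : ℕ → ℕ
fibonacci 0             = 0
fibonacci 1             = 1
fibonacci (suc (suc m)) = fibonacci (suc m) + fibonacci m

-- The division is exact: see `catalan-exact`.
catalan : ℕ → ℕ
catalan n = ((2 * n) C n) / suc n

private
  C-! : ∀ {n k} → k ≤ n → (n C k) * (k ! * (n ∸ k) !) ≡ n !
  C-! {n} {k} k≤n = trans (cong (_* (k ! * (n ∸ k) !)) (nCk≡n!/k![n-k]! k≤n))
    (m/n*n≡m {{k ℕₚ.!* (n ∸ k) !≢0}} (k![n∸k]!∣n! k≤n))

  coprime-suc : ∀ n → Coprime (suc n) n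
  coprime-suc n {d} (d₁ , d₂) = ∣1⇒≡1 (∣m+n∣m⇒∣n {m = n} {n = 1} (subst (d ∣_) (ℕₚ.+-comm 1 n) d₁) d₂)

  shift-C : ∀ m → suc m * ((2 * suc m) C suc m) ≡ ((2 * suc m) C suc (suc m)) * suc (suc m)
  shift-C m = ℕₚ.*-cancelʳ-≡ _ _ (N ! * m !) {{N ℕₚ.!* m !≢0}} (begin
    N * A * (N ! * m !)            ≡⟨ regroup₁ N A (N !) (m !) ⟩
    A * (N ! * N !)                ≡⟨ cong (λ z → A * (N ! * z !)) (sym (trans (cong (_∸ N) 2N) (ℕₚ.m+n∸n≡m N N))) ⟩
    A * (N ! * (2 * N ∸ N) !)      ≡⟨ C-! (ℕₚ.m≤m+n N _) ⟩
    (2 * N) !                      ≡⟨ sym (C-! 1+N≤2N) ⟩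
    B * ((suc N) ! * (2 * N ∸ suc N) !)
      ≡⟨ cong (λ z → B * ((suc N) ! * z !)) (trans (cong (_∸ suc N) 2N′) (ℕₚ.m+n∸n≡m m (suc N))) ⟩
    B * ((suc N) ! * m !)          ≡⟨ regroup₂ B (suc N) (N !) (m !) ⟩
    B * suc N * (N ! * m !)        ∎)
    where
    open ≡-Reasoning
    N = suc m
    A = (2 * N) C N
    B = (2 * N) C suc N
    2N : 2 * N ≡ N + N
    2N = cong (N +_) (ℕₚ.+-identityʳ N)
    2N′ : 2 * N ≡ m + suc N
    2N′ = trans 2N (sym (ℕₚ.+-suc m N))
    1+N≤2N : suc N ≤ 2 * N
    1+N≤2N = subst (suc N ≤_) (sym 2N′) (ℕₚ.m≤n+m (suc N) m)
    regroup₁ : ∀ a b c d → a * b * (c * d) ≡ b * (c * (a * d))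
    regroup₁ = solve-∀
    regroup₂ : ∀ a b c d → a * (b * c * d) ≡ a * b * (c * d)
    regroup₂ = solve-∀

catalan-exact : ∀ n → catalan n * suc n ≡ (2 * n) C n
catalan-exact n = m/n*n≡m (divides-C n)
  where
  divides-C : ∀ n → suc n ∣ (2 * n) C n
  divides-C zero    = ∣-refl
  divides-C (suc m) = coprime-divisor (coprime-suc (suc m))
    (subst (suc (suc m) ∣_) (sym (shift-C m)) (n∣m*n ((2 * suc m) C suc (suc m))))

{-# OPTIONS --safe #-}

-- Undoing an adjacent descent lowers ℓS by one, as the letter that swaps the two tracked positions
-- can be deleted from a shortest word. Shrinking an occurrence of 321 by such steps until it is
-- contiguous, a braid s₁s₂s₁ = t₁₃ of depth 2 < 3 shows dp < ℓS; likewise s₂s₁s₃s₂ = t₁₃t₂₄ shows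
-- ℓT < ℓS for 3412. Conversely dp is bounded below by the total excess Σ max(w(i) − i, 0). If w
-- avoids 321 and x is its first moved point, the descent ending at the position of x lowers the
-- excess by one, whence ℓS ≤ dp. If w also avoids 3412, then w maps x to x + 1 or x + 1 to x, and
-- undoing this letter lowers ℓT, whence ℓS ≤ ℓT. As ℓT = dp forces all letters of a word of minimal
-- depth to be adjacent, ℓT = dp is the same as ℓT = dp = ℓS.
--
-- The permutations are counted by removing one letter. For 321 the first letter j is removed,
-- leaving a 321-avoiding permutation whose values below j increase: ballot numbers. For 321 and
-- 3412 together, either 0 is fixed, or w(0) = 1, or w(1) = 0; each time the letter belongs to at
-- most one inversion and hence to no pattern.

module Submission where

open import Defs
open import Data.Nat.Base using (ℕ; _*_; _∸_; _≤_)
open import Data.Fin.Permutation using (Permutation′)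
open import Data.Product.Base using (_×_)
open import Function.Bundles using (_⇔_)
open import Relation.Binary.PropositionalEquality using (_≡_)

open import Data.Empty using (⊥; ⊥-elim)
open import Data.Fin.Base using (Fin; zero; suc; toℕ; fromℕ<; inject₁; punchIn; punchOut; _<_)
open import Data.Fin.Patterns using (0F; 1F; 2F; 3F)
import Data.Fin.Properties as Fin
open import Data.Fin.Properties using (_≟_; toℕ-injective; toℕ<n)
open import Data.Fin.Permutation as Perm
  using (_⟨$⟩ʳ_; _⟨$⟩ˡ_; _≈_; _∘ₚ_; insert; remove; inverseˡ; inverseʳ)
open import Data.Fin.Permutation.Components using (transpose; transpose-inverse)
open import Data.Fin.Permutation.Transposition.List using (TranspositionList; eval)
open import Data.List.Base using ([]; _∷_; _++_; length; map)
import Data.List.Properties as List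
open import Data.List.Relation.Unary.All as All using (All; []; _∷_)
import Data.List.Relation.Unary.All.Properties as All
open import Data.Nat.Base as ℕ using (zero; suc; _+_; s≤s; z≤n)
open import Data.Nat.Combinatorics using (_C_; nC1≡n; nCk≡nC[n∸k]; k>n⇒nCk≡0; nCk+nC[k+1]≡[n+1]C[k+1])
import Data.Nat.Properties as ℕ
open import Data.Nat.Tactic.RingSolver using (solve-∀)
open import Data.Product.Base using (∃; _,_; proj₁; proj₂)
open import Data.Sum.Base using (_⊎_; inj₁; inj₂; [_,_])
open import Function.Base using (_∘_; id)
open import Data.Sum.Function.Propositional using (_⊎-↔_)
open import Data.Vec.Base using ([]; _∷_; lookup)
open import Function.Bundles using (mk⇔; Equivalence; Inverse; _↔_)
open import Function.Construct.Composition using (_↔-∘_)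
open import Function.Construct.Identity using (↔-id)
open import Function.Construct.Symmetry using (↔-sym)
open import Level using (0ℓ)
open import Relation.Unary using (Pred)
open import Relation.Binary.Definitions using (tri<; tri≈; tri>)
open import Relation.Binary.PropositionalEquality
  using (_≢_; refl; sym; trans; cong; cong₂; subst; subst₂; module ≡-Reasoning)
open import Relation.Nullary.Decidable using (yes; no; dec-true; dec-false; _×-dec_)
open import Relation.Nullary.Negation using (¬_; contradiction)

open import Algebra.Properties.CommutativeMonoid.Sum ℕ.+-0-commutativeMonoid
  using (sum; sum-cong-≗; sum-permute; ∑-distrib-+)

private
  variable
    n : ℕ

-- Transpositions and words

-- Matching on this view replaces `k` by `i` or `j`, after which the rewriting lemmas apply. For i =
-- j two cases overlap, and `transposeView` answers `left`.
data TransposeView (i j : Fin n) : Fin n → Set where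
  left  : TransposeView i j i
  right : TransposeView i j j
  other : ∀ {k} → k ≢ i → k ≢ j → TransposeView i j k

transposeView : (i j k : Fin n) → TransposeView i j k
transposeView i j k with k ≟ i | k ≟ j
... | yes refl | _        = left
... | no _     | yes refl = right
... | no k≢i   | no k≢j   = other k≢i k≢j

transpose-matchˡ : (i j : Fin n) → transpose i j i ≡ j
transpose-matchˡ i j rewrite dec-true (i ≟ i) refl = refl

transpose-matchʳ : (i j : Fin n) → transpose i j j ≡ i
transpose-matchʳ i j with j ≟ i
... | yes refl = refl
... | no _ rewrite dec-true (j ≟ j) refl = refl

transpose-mismatch : (i j : Fin n) {k : Fin n} → k ≢ i → k ≢ j → transpose i j k ≡ k
transpose-mismatch i j {k} k≢i k≢j
  rewrite dec-false (k ≟ i) k≢i | dec-false (k ≟ j) k≢j = refl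

transpose-refl : (i k : Fin n) → transpose i i k ≡ k
transpose-refl i k with transposeView i i k
... | left          = transpose-matchˡ i i
... | right         = transpose-matchˡ i i
... | other k≢i k≢j = transpose-mismatch i i k≢i k≢j

transpose-comm : (i j k : Fin n) → transpose i j k ≡ transpose j i k
transpose-comm i j k with transposeView i j k
... | left          = trans (transpose-matchˡ i j) (sym (transpose-matchʳ j i))
... | right         = trans (transpose-matchʳ i j) (sym (transpose-matchˡ j i))
... | other k≢i k≢j = trans (transpose-mismatch i j k≢i k≢j) (sym (transpose-mismatch j i k≢j k≢i))

transpose-involutive : (i j k : Fin n) → transpose i j (transpose i j k) ≡ k
transpose-involutive i j k =
  trans (cong (transpose i j) (transpose-comm i j k)) (transpose-inverse i j)

-- Conjugation relabels a transposition. With `f` itself a transposition, this moves letters past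
-- one another.
transpose-conjugate : (f : Fin n → Fin n) → (∀ {x y} → f x ≡ f y → x ≡ y) →
                      (i j k : Fin n) → transpose (f i) (f j) (f k) ≡ f (transpose i j k)
transpose-conjugate f f-inj i j k with transposeView i j k
... | left  = trans (transpose-matchˡ (f i) (f j)) (cong f (sym (transpose-matchˡ i j)))
... | right = trans (transpose-matchʳ (f i) (f j)) (cong f (sym (transpose-matchʳ i j)))
... | other k≢i k≢j = trans (transpose-mismatch (f i) (f j) (k≢i ∘ f-inj) (k≢j ∘ f-inj))
                        (cong f (sym (transpose-mismatch i j k≢i k≢j)))

transpose-injective : (i j : Fin n) {x y : Fin n} → transpose i j x ≡ transpose i j y → x ≡ y
transpose-injective i j {x} {y} eq = begin
  x                               ≡⟨ transpose-involutive i j x ⟨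
  transpose i j (transpose i j x) ≡⟨ cong (transpose i j) eq ⟩
  transpose i j (transpose i j y) ≡⟨ transpose-involutive i j y ⟩
  y                               ∎
  where open ≡-Reasoning

-- A moved point is one of the two entries, and its image is the other.
transpose-moved : (p q x : Fin n) → transpose p q x ≢ x →
                  ∀ k → transpose p q k ≡ transpose x (transpose p q x) k
transpose-moved p q x moved k with transposeView p q x
... | left  rewrite transpose-matchˡ x q = refl
... | right rewrite transpose-matchʳ p x = transpose-comm p x k
... | other x≢p x≢q = contradiction (transpose-mismatch p q x≢p x≢q) moved

⟨$⟩ʳ-injective : (w : Permutation′ n) {x y : Fin n} → w ⟨$⟩ʳ x ≡ w ⟨$⟩ʳ y → x ≡ y
⟨$⟩ʳ-injective w eq = trans (sym (inverseˡ w)) (trans (cong (w ⟨$⟩ˡ_) eq) (inverseˡ w))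

eval-++ : (ss ts : TranspositionList n) → eval (ss ++ ts) ≈ eval ss ∘ₚ eval ts
eval-++ []             ts x = refl
eval-++ ((i , j) ∷ ss) ts x = eval-++ ss ts _

-- Cancelling pairs of the conjugating letter are inserted between consecutive letters. The
-- conjugated word has equally many letters.
eval-conjugate : (p q : Fin n) (ts : TranspositionList n) →
  eval (map (λ (i , j) → transpose p q i , transpose p q j) ts)
    ≈ Perm.transpose p q ∘ₚ eval ts ∘ₚ Perm.transpose p q
eval-conjugate p q []             x = sym (transpose-involutive p q x)
eval-conjugate p q ((i , j) ∷ ts) x = begin
  eval ts′ ⟨$⟩ʳ transpose (f i) (f j) x          ≡⟨ eval-conjugate p q ts _ ⟩
  f (eval ts ⟨$⟩ʳ f (transpose (f i) (f j) x))
    ≡⟨ cong (λ y → f (eval ts ⟨$⟩ʳ f (transpose (f i) (f j) y))) (transpose-involutive p q x) ⟨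
  f (eval ts ⟨$⟩ʳ f (transpose (f i) (f j) (f (f x))))
    ≡⟨ cong (λ y → f (eval ts ⟨$⟩ʳ f y)) (transpose-conjugate f (transpose-injective p q) i j (f x)) ⟩
  f (eval ts ⟨$⟩ʳ f (f (transpose i j (f x))))
    ≡⟨ cong (λ y → f (eval ts ⟨$⟩ʳ y)) (transpose-involutive p q _) ⟩
  f (eval ts ⟨$⟩ʳ transpose i j (f x))           ∎
  where
  open ≡-Reasoning
  f = transpose p q
  ts′ = map (λ (i , j) → f i , f j) ts

-- Conjugated letters may have their entries out of order, and a general pair may even have equal
-- ones. Such letters are flipped or dropped, so that ℓT is bounded by the length of any word of
-- pairs.
normalise : (ts : TranspositionList n) →
  ∃ λ us → All IsTransposition us × eval us ≈ eval ts × length us ≤ length ts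
normalise [] = [] , [] , (λ _ → refl) , z≤n
normalise ((i , j) ∷ ts) with normalise ts | Fin.<-cmp i j
... | us , ok , eq , le | tri< i<j _ _ = (i , j) ∷ us , i<j ∷ ok , (λ _ → eq _) , s≤s le
... | us , ok , eq , le | tri≈ _ refl _ =
  us , ok , (λ x → trans (eq x) (cong (eval ts ⟨$⟩ʳ_) (sym (transpose-refl i x)))) , ℕ.m≤n⇒m≤1+n le
... | us , ok , eq , le | tri> _ _ j<i =
  (j , i) ∷ us , j<i ∷ ok ,
  (λ x → trans (eq _) (cong (eval ts ⟨$⟩ʳ_) (transpose-comm j i x))) , s≤s le

-- Comparing the three lengths through words

ℓS≤length : ∀ {w : Permutation′ n} {ts} → All IsAdjacent ts → eval ts ≈ w → ℓS w ≤ length ts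
ℓS≤length {w = w} {ts} ok eq = proj₂ (isMinimum-ℓS w) ts (ok , eq)

dp≤TotalDepth : ∀ {w : Permutation′ n} {ts} →
                All IsTransposition ts → eval ts ≈ w → dp w ≤ TotalDepth ts
dp≤TotalDepth {w = w} {ts} ok eq = proj₂ (isMinimum-dp w) ts (ok , eq)

ℓT≤length : ∀ {w : Permutation′ n} {ts} → eval ts ≈ w → ℓT w ≤ length ts
ℓT≤length {w = w} {ts} eq with normalise ts
... | us , ok , eq′ , le =
  ℕ.≤-trans (proj₂ (isMinimum-ℓT w) us (ok , λ x → trans (eq′ x) (eq x))) le

ℓS-word : (w : Permutation′ n) → ∃ λ ts → All IsAdjacent ts × eval ts ≈ w × length ts ≡ ℓS w
ℓS-word w with isMinimum-ℓS w
... | (ts , (ok , eq) , len) , _ = ts , ok , eq , len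

ℓT-word : (w : Permutation′ n) → ∃ λ ts → All IsTransposition ts × eval ts ≈ w × length ts ≡ ℓT w
ℓT-word w with isMinimum-ℓT w
... | (ts , (ok , eq) , len) , _ = ts , ok , eq , len

dp-word : (w : Permutation′ n) → ∃ λ ts → All IsTransposition ts × eval ts ≈ w × TotalDepth ts ≡ dp w
dp-word w with isMinimum-dp w
... | (ts , (ok , eq) , len) , _ = ts , ok , eq , len

depth-adjacent : {t : Fin n × Fin n} → IsAdjacent t → depth t ≡ 1
depth-adjacent {t = i , j} eq = trans (cong (_∸ toℕ i) eq) (ℕ.m+n∸n≡m 1 (toℕ i))

TotalDepth-adjacent : {ts : TranspositionList n} → All IsAdjacent ts → TotalDepth ts ≡ length ts
TotalDepth-adjacent []       = refl
TotalDepth-adjacent {ts = t ∷ _} (p ∷ ps) =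
  cong₂ _+_ (depth-adjacent {t = t} p) (TotalDepth-adjacent ps)

adjacent⇒transposition : {ts : TranspositionList n} → All IsAdjacent ts → All IsTransposition ts
adjacent⇒transposition = All.map (ℕ.≤-reflexive ∘ sym)

length≤TotalDepth : {ts : TranspositionList n} → All IsTransposition ts → length ts ≤ TotalDepth ts
length≤TotalDepth []       = z≤n
length≤TotalDepth (p ∷ ps) = ℕ.+-mono-≤ (ℕ.m<n⇒0<n∸m p) (length≤TotalDepth ps)

dp≤ℓS : (w : Permutation′ n) → dp w ≤ ℓS w
dp≤ℓS w with ℓS-word w
... | ts , ok , eq , len = ℕ.≤-trans (dp≤TotalDepth (adjacent⇒transposition ok) eq)
                             (ℕ.≤-reflexive (trans (TotalDepth-adjacent ok) len))

ℓT≤dp : (w : Permutation′ n) → ℓT w ≤ dp w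
ℓT≤dp w with dp-word w
... | ts , ok , eq , len = ℕ.≤-trans (ℓT≤length {ts = ts} eq)
                             (ℕ.≤-trans (length≤TotalDepth ok) (ℕ.≤-reflexive len))

-- Every letter has depth at least one, so a total depth no larger than the length forces each depth
-- to be exactly one.
tight⇒adjacent : {ts : TranspositionList n} → All IsTransposition ts →
                 TotalDepth ts ≤ length ts → All IsAdjacent ts
tight⇒adjacent [] _ = []
tight⇒adjacent {ts = (i , j) ∷ ts} (p ∷ ps) le =
  ℕ.≤-antisym j≤1+i p ∷ tight⇒adjacent ps (ℕ.+-cancelˡ-≤ 1 _ _
    (ℕ.≤-trans (ℕ.+-monoˡ-≤ (TotalDepth ts) (ℕ.m<n⇒0<n∸m p)) le))
  where
  d≤1 : depth (i , j) ≤ 1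
  d≤1 = ℕ.+-cancelʳ-≤ (TotalDepth ts) _ _
          (ℕ.≤-trans le (ℕ.+-monoʳ-≤ 1 (length≤TotalDepth ps)))
  j≤1+i : toℕ j ≤ suc (toℕ i)
  j≤1+i = ℕ.≤-trans (ℕ.m≤n+m∸n (toℕ j) (toℕ i))
            (ℕ.≤-trans (ℕ.+-monoʳ-≤ (toℕ i) d≤1) (ℕ.≤-reflexive (ℕ.+-comm (toℕ i) 1)))

-- A word of minimal depth has length between ℓT and dp. If these agree, all its letters are
-- adjacent, and its length bounds ℓS.
ℓT≡dp⇒dp≡ℓS : (w : Permutation′ n) → ℓT w ≡ dp w → dp w ≡ ℓS w
ℓT≡dp⇒dp≡ℓS w tight with dp-word w
... | ts , ok , eq , len = ℕ.≤-antisym (dp≤ℓS w) (ℕ.≤-trans (ℓS≤length adj eq) len≤dp)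
  where
  len≤dp : length ts ≤ dp w
  len≤dp = ℕ.≤-trans (length≤TotalDepth ok) (ℕ.≤-reflexive len)
  adj : All IsAdjacent ts
  adj = tight⇒adjacent ok
    (ℕ.≤-trans (ℕ.≤-reflexive (trans len (sym tight))) (ℓT≤length {ts = ts} eq))

-- Undoing a single letter

_·_ : (t : Fin n × Fin n) → Permutation′ n → Permutation′ n
(i , j) · w = Perm.transpose i j ∘ₚ w

infixr 8 _·_

-- A transposition is its own inverse, so putting `t` in front of a word for `t · w` gives a word
-- for `w`. The step bounds for all three weights rest on this.
eval-· : ∀ {w : Permutation′ n} {ts} t → eval ts ≈ t · w → eval (t ∷ ts) ≈ w
eval-· {w = w} (i , j) eq x = trans (eq _) (cong (w ⟨$⟩ʳ_) (transpose-involutive i j x))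

dp-step : (w : Permutation′ n) {t : Fin n × Fin n} → IsTransposition t → dp w ≤ depth t + dp (t · w)
dp-step w {t} ok′ with dp-word (t · w)
... | ts , ok , eq , len = ℕ.≤-trans (dp≤TotalDepth (ok′ ∷ ok) (eval-· {w = w} {ts} t eq))
                             (ℕ.≤-reflexive (cong (depth t +_) len))

ℓT-step : (w : Permutation′ n) (t : Fin n × Fin n) → ℓT w ≤ suc (ℓT (t · w))
ℓT-step w t with ℓT-word (t · w)
... | ts , ok , eq , len = ℕ.≤-trans (ℓT≤length {ts = t ∷ ts} (eval-· {w = w} {ts} t eq))
                             (ℕ.≤-reflexive (cong suc len))

ℓS-step : (w : Permutation′ n) {t : Fin n × Fin n} → IsAdjacent t → ℓS w ≤ suc (ℓS (t · w))
ℓS-step w {t} ok′ with ℓS-word (t · w)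
... | ts , ok , eq , len = ℕ.≤-trans (ℓS≤length (ok′ ∷ ok) (eval-· {w = w} {ts} t eq))
                             (ℕ.≤-reflexive (cong suc len))

-- Permutations that agree as functions may differ as records, so the minima are compared through
-- words.
ℓT-cong : {v w : Permutation′ n} → v ≈ w → ℓT v ≤ ℓT w
ℓT-cong {w = w} v≈w with ℓT-word w
... | ts , _ , eq , len =
  ℕ.≤-trans (ℓT≤length {ts = ts} (λ x → trans (eq x) (sym (v≈w x)))) (ℕ.≤-reflexive len)

dp-cong : {v w : Permutation′ n} → v ≈ w → dp v ≤ dp w
dp-cong {w = w} v≈w with dp-word w
... | ts , ok , eq , len =
  ℕ.≤-trans (dp≤TotalDepth ok (λ x → trans (eq x) (sym (v≈w x)))) (ℕ.≤-reflexive len)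

-- Exchange properties

-- Nothing lies strictly between p and q, so their exchange reverses no order but their own. The
-- lemma serves for positions and for values.
adjacent-transpose-< : {p q : Fin n} → IsAdjacent (p , q) → {i j : Fin n} → i < j →
                       ¬ (i ≡ p × j ≡ q) → transpose p q i < transpose p q j
adjacent-transpose-< {p = p} {q} adj {i} {j} i<j other-pair
  with transposeView p q i | transposeView p q j
... | left  | left  = contradiction i<j (ℕ.<-irrefl refl)
... | left  | right = contradiction (refl , refl) other-pair
... | left  | other j≢p j≢q
  rewrite transpose-matchˡ p q | transpose-mismatch p q j≢p j≢q =
  ℕ.≤∧≢⇒< (ℕ.≤-trans (ℕ.≤-reflexive adj) i<j) (λ eq → j≢q (sym (toℕ-injective eq)))
... | right | left  = contradiction i<j (ℕ.<-asym (ℕ.≤-reflexive (sym adj)))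
... | right | right = contradiction i<j (ℕ.<-irrefl refl)
... | right | other j≢p j≢q
  rewrite transpose-matchʳ p q | transpose-mismatch p q j≢p j≢q =
  ℕ.<-trans (ℕ.≤-reflexive (sym adj)) i<j
... | other i≢p i≢q | left
  rewrite transpose-matchˡ p q | transpose-mismatch p q i≢p i≢q =
  ℕ.<-trans i<j (ℕ.≤-reflexive (sym adj))
... | other i≢p i≢q | right
  rewrite transpose-matchʳ p q | transpose-mismatch p q i≢p i≢q =
  ℕ.≤∧≢⇒< (ℕ.≤-pred (ℕ.≤-trans i<j (ℕ.≤-reflexive adj))) (λ eq → i≢p (toℕ-injective eq))
... | other i≢p i≢q | other j≢p j≢q
  rewrite transpose-mismatch p q i≢p i≢q | transpose-mismatch p q j≢p j≢q = i<j

-- Following i and j along the word, some letter must exchange them; it is deleted.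
delete-letter : (ts : TranspositionList n) → All IsAdjacent ts → (i j : Fin n) → i < j →
  (eval ts ⟨$⟩ʳ j) < (eval ts ⟨$⟩ʳ i) →
  ∃ λ us → All IsAdjacent us × eval us ≈ (i , j) · eval ts × suc (length us) ≡ length ts
delete-letter [] _ i j i<j inv = contradiction inv (ℕ.<-asym i<j)
delete-letter ((p , q) ∷ ts) (adj ∷ ok) i j i<j inv with (i ≟ p) ×-dec (j ≟ q)
... | yes (refl , refl) =
  ts , ok , (λ x → cong (eval ts ⟨$⟩ʳ_) (sym (transpose-involutive p q x))) , refl
... | no other-pair
  with us , ok′ , eq , len ← delete-letter ts ok (transpose p q i) (transpose p q j)
                               (adjacent-transpose-< adj i<j other-pair) inv =
  (p , q) ∷ us , adj ∷ ok′ ,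
  (λ x → trans (eq _) (cong (eval ts ⟨$⟩ʳ_)
           (transpose-conjugate (transpose p q) (transpose-injective p q) i j x))) ,
  cong suc len

-- A form of the strong exchange condition: the inversion undone need not be adjacent.
ℓS-inversion : (w : Permutation′ n) {i j : Fin n} → i < j → (w ⟨$⟩ʳ j) < (w ⟨$⟩ʳ i) →
               suc (ℓS ((i , j) · w)) ≤ ℓS w
ℓS-inversion w {i} {j} i<j inv with ℓS-word w
... | ts , ok , eq , len
  with us , ok′ , eq′ , len′ ← delete-letter ts ok i j i<j
                                 (subst₂ _<_ (sym (eq j)) (sym (eq i)) inv) =
  ℕ.≤-trans (s≤s (ℓS≤length ok′ λ x → trans (eq′ x) (eq _))) (ℕ.≤-reflexive (trans len′ len))

-- Only the orbit of x is followed; the letter that brings it to a is deleted.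
split-cycle : (ts : TranspositionList n) (x a : Fin n) → eval ts ⟨$⟩ʳ x ≡ a → x ≢ a →
  ∃ λ us → eval us ≈ (x , a) · eval ts × suc (length us) ≡ length ts
split-cycle [] x a x≡a x≢a = contradiction x≡a x≢a
split-cycle ((p , q) ∷ ts) x a tx≡a x≢a with transpose p q x ≟ a
... | yes refl = ts , (λ z → cong (eval ts ⟨$⟩ʳ_) (sym (begin
    transpose p q (transpose x a z)   ≡⟨ transpose-moved p q x (x≢a ∘ sym) (transpose x a z) ⟩
    transpose x a (transpose x a z)   ≡⟨ transpose-involutive x a z ⟩
    z                                 ∎))) , refl
  where open ≡-Reasoning
... | no y≢a with us , eq , len ← split-cycle ts (transpose p q x) a tx≡a y≢a | transpose p q x ≟ x
-- The letter fixes x but may move a, so it changes when (x , a) is moved in front of it: it is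
-- conjugated by (x , a).
...   | yes y≡x = (f p , f q) ∷ us , (λ z → begin
    eval us ⟨$⟩ʳ transpose (f p) (f q) z
      ≡⟨ eq _ ⟩
    eval ts ⟨$⟩ʳ transpose (transpose p q x) a (transpose (f p) (f q) z)
      ≡⟨ cong (λ y → eval ts ⟨$⟩ʳ transpose y a (transpose (f p) (f q) z)) y≡x ⟩
    eval ts ⟨$⟩ʳ f (transpose (f p) (f q) z)
      ≡⟨ cong (λ y → eval ts ⟨$⟩ʳ f (transpose (f p) (f q) y)) (transpose-involutive x a z) ⟨
    eval ts ⟨$⟩ʳ f (transpose (f p) (f q) (f (f z)))
      ≡⟨ cong (λ y → eval ts ⟨$⟩ʳ f y) (transpose-conjugate f (transpose-injective x a) p q (f z)) ⟩
    eval ts ⟨$⟩ʳ f (f (transpose p q (f z)))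
      ≡⟨ cong (eval ts ⟨$⟩ʳ_) (transpose-involutive x a _) ⟩
    eval ts ⟨$⟩ʳ transpose p q (f z) ∎) , cong suc len
  where
  open ≡-Reasoning
  f = transpose x a
-- The letter is (x , f x) and fixes a. It conjugates (f x , a) to (x , a) and stays in the word
-- unchanged.
...   | no y≢x = (p , q) ∷ us , (λ z → begin
    eval us ⟨$⟩ʳ f z                  ≡⟨ eq _ ⟩
    eval ts ⟨$⟩ʳ transpose (f x) a (f z)
      ≡⟨ cong (λ y → eval ts ⟨$⟩ʳ transpose (f x) y (f z)) fa≡a ⟨
    eval ts ⟨$⟩ʳ transpose (f x) (f a) (f z)
      ≡⟨ cong (eval ts ⟨$⟩ʳ_) (transpose-conjugate f (transpose-injective p q) x a z) ⟩
    eval ts ⟨$⟩ʳ f (transpose x a z)  ∎) , cong suc len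
  where
  open ≡-Reasoning
  f = transpose p q
  fa≡a : f a ≡ a
  fa≡a = trans (transpose-moved p q x y≢x a) (transpose-mismatch x (f x) (x≢a ∘ sym) (y≢a ∘ sym))

-- The permutation `(x , a) · w` fixes a: one point is split off its cycle.
ℓT-split : (w : Permutation′ n) {x a : Fin n} → w ⟨$⟩ʳ x ≡ a → x ≢ a →
           suc (ℓT ((x , a) · w)) ≤ ℓT w
ℓT-split w {x} {a} wx≡a x≢a with ℓT-word w
... | ts , _ , eq , len
  with us , eq′ , len′ ← split-cycle ts x a (trans (eq x) wx≡a) x≢a =
  ℕ.≤-trans (s≤s (ℓT≤length {ts = us} λ z → trans (eq′ z) (eq _))) (ℕ.≤-reflexive (trans len′ len))

-- Multiplying by (x , a) on one side or on the other gives conjugate permutations, so `ℓT-split`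
-- carries over by conjugating a shortest word.
ℓT-splitʳ : (w : Permutation′ n) {x a : Fin n} → w ⟨$⟩ʳ x ≡ a → x ≢ a →
            suc (ℓT (w ∘ₚ Perm.transpose x a)) ≤ ℓT w
ℓT-splitʳ w {x} {a} wx≡a x≢a with ℓT-word ((x , a) · w)
... | ts , _ , eq , len = ℕ.≤-trans (s≤s (ℕ.≤-trans
    (ℓT≤length {ts = map (λ (i , j) → f i , f j) ts} λ z → trans (eval-conjugate x a ts z)
      (cong f (trans (eq _) (cong (w ⟨$⟩ʳ_) (transpose-involutive x a z)))))
    (ℕ.≤-reflexive (trans (List.length-map _ ts) len)))) (ℓT-split w wx≡a x≢a)
  where f = transpose x a

ℓS-stepʳ : (w : Permutation′ n) {p q : Fin n} → IsAdjacent (p , q) →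
           ℓS w ≤ suc (ℓS (w ∘ₚ Perm.transpose p q))
ℓS-stepʳ w {p} {q} adj with ℓS-word (w ∘ₚ Perm.transpose p q)
... | ts , ok , eq , len = ℕ.≤-trans
  (ℓS≤length (All.++⁺ ok (adj ∷ [])) λ x → trans (eval-++ ts _ x)
    (trans (cong (transpose p q) (eq x)) (transpose-involutive p q _)))
  (ℕ.≤-reflexive (trans (List.length-++ ts) (trans (ℕ.+-comm _ 1) (cong suc len))))

-- Patterns

-- Containment reduced to comparisons of neighbours in position and in value; `contains-321⇔` gives
-- the agreement with `Contains`.
Has321 : Permutation′ n → Set
Has321 w = ∃ λ i → ∃ λ j → ∃ λ k → i < j × j < k ×
  (w ⟨$⟩ʳ j) < (w ⟨$⟩ʳ i) × (w ⟨$⟩ʳ k) < (w ⟨$⟩ʳ j)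

Has3412 : Permutation′ n → Set
Has3412 w = ∃ λ i → ∃ λ j → ∃ λ k → ∃ λ l → i < j × j < k × k < l ×
  (w ⟨$⟩ʳ k) < (w ⟨$⟩ʳ l) × (w ⟨$⟩ʳ l) < (w ⟨$⟩ʳ i) × (w ⟨$⟩ʳ i) < (w ⟨$⟩ʳ j)

<⇒≢ : {i j : Fin n} → i < j → i ≢ j
<⇒≢ i<j refl = ℕ.<-irrefl refl i<j

>⇒≢ : {i j : Fin n} → j < i → i ≢ j
>⇒≢ j<i refl = ℕ.<-irrefl refl j<i

successor : {i j : Fin n} → i < j → ∃ λ k → IsAdjacent (i , k)
successor {j = j} i<j =
  fromℕ< (ℕ.≤-<-trans i<j (toℕ<n j)) , Fin.toℕ-fromℕ< _

predecessor : {i j : Fin n} → i < j → ∃ λ k → IsAdjacent (k , j)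
predecessor {j = suc j} _ = inject₁ j , cong suc (sym (Fin.toℕ-inject₁ j))

adjacent⇒< : {i j : Fin n} → IsAdjacent (i , j) → i < j
adjacent⇒< adj = ℕ.≤-reflexive (sym adj)

successor-< : {i j k : Fin n} → IsAdjacent (i , k) → i < j → k ≢ j → k < j
successor-< adj i<j k≢j = ℕ.≤∧≢⇒< (ℕ.≤-trans (ℕ.≤-reflexive adj) i<j) (k≢j ∘ toℕ-injective)

predecessor-< : {i j k : Fin n} → IsAdjacent (k , j) → i < j → i ≢ k → i < k
predecessor-< adj i<j i≢k =
  ℕ.≤∧≢⇒< (ℕ.≤-pred (ℕ.≤-trans i<j (ℕ.≤-reflexive adj))) (i≢k ∘ toℕ-injective)

at-left : (w : Permutation′ n) (i j : Fin n) → (i , j) · w ⟨$⟩ʳ i ≡ w ⟨$⟩ʳ j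
at-left w i j = cong (w ⟨$⟩ʳ_) (transpose-matchˡ i j)

at-right : (w : Permutation′ n) (i j : Fin n) → (i , j) · w ⟨$⟩ʳ j ≡ w ⟨$⟩ʳ i
at-right w i j = cong (w ⟨$⟩ʳ_) (transpose-matchʳ i j)

at-other : (w : Permutation′ n) (i j : Fin n) {k : Fin n} → k ≢ i → k ≢ j →
           (i , j) · w ⟨$⟩ʳ k ≡ w ⟨$⟩ʳ k
at-other w i j k≢i k≢j = cong (w ⟨$⟩ʳ_) (transpose-mismatch i j k≢i k≢j)

value-cmp : (w : Permutation′ n) {x y : Fin n} → x ≢ y →
            ((w ⟨$⟩ʳ x) < (w ⟨$⟩ʳ y)) ⊎ ((w ⟨$⟩ʳ y) < (w ⟨$⟩ʳ x))
value-cmp w {x} {y} x≢y with Fin.<-cmp (w ⟨$⟩ʳ x) (w ⟨$⟩ʳ y)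
... | tri< lt _ _ = inj₁ lt
... | tri≈ _ eq _ = contradiction (⟨$⟩ʳ-injective w eq) x≢y
... | tri> _ _ gt = inj₂ gt

transpose-braid : (i j k : Fin n) → i ≢ j → i ≢ k → j ≢ k → ∀ x →
  transpose i j (transpose j k (transpose i j x)) ≡ transpose i k x
transpose-braid i j k i≢j i≢k j≢k x = begin
  f (transpose j k (f x))             ≡⟨ transpose-conjugate f (transpose-injective i j) j k (f x) ⟨
  transpose (f j) (f k) (f (f x))     ≡⟨ cong (transpose (f j) (f k)) (transpose-involutive i j x) ⟩
  transpose (f j) (f k) x
    ≡⟨ cong₂ (λ y z → transpose y z x) (transpose-matchʳ i j) (transpose-mismatch i j (i≢k ∘ sym) (j≢k ∘ sym)) ⟩
  transpose i k x                     ∎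
  where
  open ≡-Reasoning
  f = transpose i j

-- A wide occurrence of 321 is narrowed, either directly or after undoing a descent. A contiguous
-- one is undone by a braid of three adjacent transpositions, which has depth two.
321⇒dp<ℓS′ : ∀ g (w : Permutation′ n) {i j k} → toℕ k ≤ toℕ i + g → i < j → j < k →
  (w ⟨$⟩ʳ j) < (w ⟨$⟩ʳ i) → (w ⟨$⟩ʳ k) < (w ⟨$⟩ʳ j) → dp w ℕ.< ℓS w
321⇒dp<ℓS′ zero w {i} {j} {k} le i<j j<k ji kj =
  contradiction (ℕ.<-trans i<j j<k) (ℕ.≤⇒≯ (ℕ.≤-trans le (ℕ.≤-reflexive (ℕ.+-identityʳ _))))
321⇒dp<ℓS′ {n} (suc g) w {i} {j} {k} le i<j j<k ji kj with successor i<j | predecessor j<k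
... | x , adjx | y , adjy with x ≟ j | j ≟ y
... | yes refl | yes refl = begin-strict
    dp w                            ≤⟨ dp-step w {i , k} (ℕ.<-trans i<j j<k) ⟩
    depth (i , k) + dp ((i , k) · w) ≡⟨ cong (_+ dp ((i , k) · w)) depth≡2 ⟩
    2 + dp ((i , k) · w)
      ≤⟨ ℕ.+-monoʳ-≤ 2 (dp-cong {w = w₃} λ z → cong (w ⟨$⟩ʳ_) (sym (transpose-braid i j k (<⇒≢ i<j) (<⇒≢ i<k) (<⇒≢ j<k) z))) ⟩
    2 + dp w₃                       ≤⟨ ℕ.+-monoʳ-≤ 2 (dp≤ℓS w₃) ⟩
    2 + ℓS w₃                       <⟨ ℕ.≤-refl ⟩
    3 + ℓS w₃                       ≤⟨ ℕ.+-monoʳ-≤ 2 (ℓS-inversion w₂ i<j inv₃) ⟩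
    2 + ℓS w₂                       ≤⟨ ℕ.+-monoʳ-≤ 1 (ℓS-inversion w₁ j<k inv₂) ⟩
    1 + ℓS w₁                       ≤⟨ ℓS-inversion w i<j ji ⟩
    ℓS w                            ∎
  where
  open ℕ.≤-Reasoning
  i<k = ℕ.<-trans i<j j<k
  w₁ = (i , j) · w
  w₂ = (j , k) · w₁
  w₃ = (i , j) · w₂
  depth≡2 : depth (i , k) ≡ 2
  depth≡2 = trans (cong (_∸ toℕ i) (trans adjy (cong suc adjx))) (ℕ.m+n∸n≡m 2 (toℕ i))
  w₁k : w₁ ⟨$⟩ʳ k ≡ w ⟨$⟩ʳ k
  w₁k = at-other w i j (>⇒≢ i<k) (>⇒≢ j<k)
  inv₂ : (w₁ ⟨$⟩ʳ k) < (w₁ ⟨$⟩ʳ j)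
  inv₂ = subst₂ _<_ (sym w₁k) (sym (at-right w i j)) (ℕ.<-trans kj ji)
  inv₃ : (w₂ ⟨$⟩ʳ j) < (w₂ ⟨$⟩ʳ i)
  inv₃ = subst₂ _<_ (sym (trans (at-left w₁ j k) w₁k))
           (sym (trans (at-other w₁ j k (<⇒≢ i<j) (<⇒≢ i<k)) (at-left w i j))) kj
... | no x≢j | _ with value-cmp w {x} {j} x≢j
...   | inj₂ jx = 321⇒dp<ℓS′ g w
        (ℕ.≤-trans le (ℕ.≤-reflexive (trans (ℕ.+-suc _ g) (cong (_+ g) (sym adjx)))))
        (successor-< adjx i<j x≢j) j<k jx kj
-- Now w(x) < w(j) < w(i), so i, x is a descent. Undoing it brings the largest value to x, and the
-- pattern survives at x, j, k.
...   | inj₁ xj = begin-strict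
    dp w                  ≤⟨ dp-step w {i , x} (adjacent⇒< adjx) ⟩
    depth (i , x) + dp w′ ≡⟨ cong (_+ dp w′) (depth-adjacent {t = i , x} adjx) ⟩
    1 + dp w′             <⟨ s≤s (321⇒dp<ℓS′ g w′
        (ℕ.≤-trans le (ℕ.≤-reflexive (trans (ℕ.+-suc _ g) (cong (_+ g) (sym adjx)))))
        x<j j<k
        (subst₂ _<_ (sym w′j) (sym (at-right w i x)) ji)
        (subst₂ _<_ (sym w′k) (sym w′j) kj)) ⟩
    1 + ℓS w′             ≤⟨ ℓS-inversion w (adjacent⇒< adjx) (ℕ.<-trans xj ji) ⟩
    ℓS w                  ∎
  where
  open ℕ.≤-Reasoning
  w′ = (i , x) · w
  x<j = successor-< {j = j} adjx i<j x≢j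
  w′j : w′ ⟨$⟩ʳ j ≡ w ⟨$⟩ʳ j
  w′j = at-other w i x (>⇒≢ i<j) (x≢j ∘ sym)
  w′k : w′ ⟨$⟩ʳ k ≡ w ⟨$⟩ʳ k
  w′k = at-other w i x (>⇒≢ (ℕ.<-trans i<j j<k)) (>⇒≢ (ℕ.<-trans x<j j<k))
321⇒dp<ℓS′ {n} (suc g) w {i} {j} {k} le i<j j<k ji kj | x , adjx | y , adjy | yes _ | no j≢y
  with value-cmp w {y} {j} (j≢y ∘ sym)
...   | inj₁ yj = 321⇒dp<ℓS′ g w
        (ℕ.≤-pred (ℕ.≤-trans (ℕ.≤-reflexive (sym adjy)) (ℕ.≤-trans le (ℕ.≤-reflexive (ℕ.+-suc _ g)))))
        i<j (predecessor-< adjy j<k j≢y) ji yj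
...   | inj₂ jy = begin-strict
    dp w                  ≤⟨ dp-step w {y , k} (adjacent⇒< adjy) ⟩
    depth (y , k) + dp w′ ≡⟨ cong (_+ dp w′) (depth-adjacent {t = y , k} adjy) ⟩
    1 + dp w′             <⟨ s≤s (321⇒dp<ℓS′ g w′
        (ℕ.≤-pred (ℕ.≤-trans (ℕ.≤-reflexive (sym adjy)) (ℕ.≤-trans le (ℕ.≤-reflexive (ℕ.+-suc _ g)))))
        i<j j<y
        (subst₂ _<_ (sym w′j) (sym w′i) ji)
        (subst₂ _<_ (sym (at-left w y k)) (sym w′j) kj)) ⟩
    1 + ℓS w′             ≤⟨ ℓS-inversion w (adjacent⇒< adjy) (ℕ.<-trans kj jy) ⟩
    ℓS w                  ∎
  where
  open ℕ.≤-Reasoning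
  w′ = (y , k) · w
  j<y = predecessor-< {i = j} adjy j<k j≢y
  w′j : w′ ⟨$⟩ʳ j ≡ w ⟨$⟩ʳ j
  w′j = at-other w y k j≢y (<⇒≢ j<k)
  w′i : w′ ⟨$⟩ʳ i ≡ w ⟨$⟩ʳ i
  w′i = at-other w y k (<⇒≢ (ℕ.<-trans i<j j<y)) (<⇒≢ (ℕ.<-trans i<j j<k))

321⇒dp<ℓS : (w : Permutation′ n) → Has321 w → dp w ℕ.< ℓS w
321⇒dp<ℓS w (i , j , k , i<j , j<k , ji , kj) =
  321⇒dp<ℓS′ (toℕ k) w (ℕ.m≤n+m _ _) i<j j<k ji kj

-- Undoing a descent lowers ℓS by at least one and ℓT by at most one, so a strict gap carries back
-- to w.
ℓT<ℓS-descent : (w : Permutation′ n) {i j : Fin n} → i < j → (w ⟨$⟩ʳ j) < (w ⟨$⟩ʳ i) →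
                ℓT ((i , j) · w) ℕ.< ℓS ((i , j) · w) → ℓT w ℕ.< ℓS w
ℓT<ℓS-descent w {i} {j} i<j inv lt =
  ℕ.≤-<-trans (ℓT-step w (i , j)) (ℕ.≤-trans (s≤s lt) (ℓS-inversion w i<j inv))

-- A contiguous 3412 is undone by the four adjacent transpositions s₂ s₁ s₃ s₂, whose product is
-- also the product of the two transpositions exchanging 3 with 1 and 4 with 2.
contiguous-3412⇒ℓT<ℓS : (w : Permutation′ n) {i j k l : Fin n} → i < j → j < k → k < l →
  (w ⟨$⟩ʳ k) < (w ⟨$⟩ʳ l) → (w ⟨$⟩ʳ l) < (w ⟨$⟩ʳ i) → (w ⟨$⟩ʳ i) < (w ⟨$⟩ʳ j) →
  ℓT w ℕ.< ℓS w
contiguous-3412⇒ℓT<ℓS w {i} {j} {k} {l} i<j j<k k<l kl li ij = begin-strict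
    ℓT w                              ≤⟨ ℓT-step w (i , k) ⟩
    1 + ℓT ((i , k) · w)              ≤⟨ ℕ.+-monoʳ-≤ 1 (ℓT-step ((i , k) · w) (j , l)) ⟩
    2 + ℓT ((j , l) · (i , k) · w)    ≤⟨ ℕ.+-monoʳ-≤ 2 (ℓT-cong {w = w₄} same) ⟩
    2 + ℓT w₄                         ≤⟨ ℕ.+-monoʳ-≤ 2 (ℕ.≤-trans (ℓT≤dp w₄) (dp≤ℓS w₄)) ⟩
    2 + ℓS w₄                         <⟨ ℕ.n≤1+n _ ⟩
    4 + ℓS w₄                         ≤⟨ ℕ.+-monoʳ-≤ 3 (ℓS-inversion w₃ j<k inv₄) ⟩
    3 + ℓS w₃                         ≤⟨ ℕ.+-monoʳ-≤ 2 (ℓS-inversion w₂ k<l inv₃) ⟩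
    2 + ℓS w₂                         ≤⟨ ℕ.+-monoʳ-≤ 1 (ℓS-inversion w₁ i<j inv₂) ⟩
    1 + ℓS w₁                         ≤⟨ ℓS-inversion w j<k (ℕ.<-trans kl (ℕ.<-trans li ij)) ⟩
    ℓS w                              ∎
  where
  open ℕ.≤-Reasoning
  i<k = ℕ.<-trans i<j j<k
  j<l = ℕ.<-trans j<k k<l
  i<l = ℕ.<-trans i<k k<l
  w₁ = (j , k) · w
  w₂ = (i , j) · w₁
  w₃ = (k , l) · w₂
  w₄ = (j , k) · w₃
  w₁i : w₁ ⟨$⟩ʳ i ≡ w ⟨$⟩ʳ i
  w₁i = at-other w j k (<⇒≢ i<j) (<⇒≢ i<k)
  w₁l : w₁ ⟨$⟩ʳ l ≡ w ⟨$⟩ʳ l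
  w₁l = at-other w j k (>⇒≢ j<l) (>⇒≢ k<l)
  w₂j : w₂ ⟨$⟩ʳ j ≡ w ⟨$⟩ʳ i
  w₂j = trans (at-right w₁ i j) w₁i
  w₂k : w₂ ⟨$⟩ʳ k ≡ w ⟨$⟩ʳ j
  w₂k = trans (at-other w₁ i j (>⇒≢ i<k) (>⇒≢ j<k)) (at-right w j k)
  w₂l : w₂ ⟨$⟩ʳ l ≡ w ⟨$⟩ʳ l
  w₂l = trans (at-other w₁ i j (>⇒≢ i<l) (>⇒≢ j<l)) w₁l
  inv₂ : (w₁ ⟨$⟩ʳ j) < (w₁ ⟨$⟩ʳ i)
  inv₂ = subst₂ _<_ (sym (at-left w j k)) (sym w₁i) (ℕ.<-trans kl li)
  inv₃ : (w₂ ⟨$⟩ʳ l) < (w₂ ⟨$⟩ʳ k)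
  inv₃ = subst₂ _<_ (sym w₂l) (sym w₂k) (ℕ.<-trans li ij)
  inv₄ : (w₃ ⟨$⟩ʳ k) < (w₃ ⟨$⟩ʳ j)
  inv₄ = subst₂ _<_ (sym (trans (at-left w₂ k l) w₂l))
           (sym (trans (at-other w₂ k l (<⇒≢ j<k) (<⇒≢ j<l)) w₂j)) li
  same : (j , l) · (i , k) · w ≈ w₄
  same x = cong (w ⟨$⟩ʳ_) (sym (≡.begin
    t (transpose i j (transpose k l (t x)))
      ≡.≡⟨ transpose-conjugate t (transpose-injective j k) i j (transpose k l (t x)) ⟨
    transpose (t i) (t j) (t (transpose k l (t x)))
      ≡.≡⟨ cong (transpose (t i) (t j)) (transpose-conjugate t (transpose-injective j k) k l (t x)) ⟨
    transpose (t i) (t j) (transpose (t k) (t l) (t (t x)))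
      ≡.≡⟨ cong (λ y → transpose (t i) (t j) (transpose (t k) (t l) y)) (transpose-involutive j k x) ⟩
    transpose (t i) (t j) (transpose (t k) (t l) x)
      ≡.≡⟨ cong₂ (λ y z → transpose y z (transpose (t k) (t l) x)) (transpose-mismatch j k (<⇒≢ i<j) (<⇒≢ i<k)) (transpose-matchˡ j k) ⟩
    transpose i k (transpose (t k) (t l) x)
      ≡.≡⟨ cong₂ (λ y z → transpose i k (transpose y z x)) (transpose-matchʳ j k) (transpose-mismatch j k (>⇒≢ j<l) (>⇒≢ k<l)) ⟩
    transpose i k (transpose j l x) ≡.∎))
    where
    module ≡ = ≡-Reasoning
    t = transpose j k

321⇒ℓT<ℓS : (w : Permutation′ n) → Has321 w → ℓT w ℕ.< ℓS w
321⇒ℓT<ℓS w p = ℕ.≤-<-trans (ℓT≤dp w) (321⇒dp<ℓS w p)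

-- Here `g` bounds (l - i) + (k - j), which drops when any of the three gaps between positions is
-- narrowed. The neighbouring letter inside a gap either takes a place in the pattern, or completes
-- a 321, or forms a descent to be undone.
3412⇒ℓT<ℓS′ : ∀ g (w : Permutation′ n) {i j k l} →
  toℕ l + toℕ k ≤ toℕ i + toℕ j + g → i < j → j < k → k < l →
  (w ⟨$⟩ʳ k) < (w ⟨$⟩ʳ l) → (w ⟨$⟩ʳ l) < (w ⟨$⟩ʳ i) → (w ⟨$⟩ʳ i) < (w ⟨$⟩ʳ j) →
  ℓT w ℕ.< ℓS w
3412⇒ℓT<ℓS′ zero w le i<j j<k k<l _ _ _ =
  contradiction (ℕ.+-mono-< (ℕ.<-trans i<j (ℕ.<-trans j<k k<l)) j<k)
    (ℕ.≤⇒≯ (ℕ.≤-trans le (ℕ.≤-reflexive (ℕ.+-identityʳ _))))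
3412⇒ℓT<ℓS′ (suc g) w {i} {j} {k} {l} le i<j j<k k<l kl li ij
  with x , adjx ← successor i<j | y , adjy ← predecessor k<l | z , adjz ← successor j<k
  with x ≟ j | k ≟ y | z ≟ k
... | yes refl | yes refl | yes refl = contiguous-3412⇒ℓT<ℓS w i<j j<k k<l kl li ij
... | no x≢j | _ | _ = shrink
  where
  x<j = successor-< {j = j} adjx i<j x≢j
  i<x = adjacent⇒< {i = i} adjx
  le′ : toℕ l + toℕ k ≤ toℕ x + toℕ j + g
  le′ = ℕ.≤-trans le (ℕ.≤-reflexive (trans (ℕ.+-suc _ g) (cong (λ a → a + toℕ j + g) (sym adjx))))
  shrink : ℓT w ℕ.< ℓS w
  shrink with value-cmp w {x} {i} (>⇒≢ i<x) | value-cmp w {x} {j} x≢j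
  ... | inj₂ ix | inj₁ xj = 3412⇒ℓT<ℓS′ g w le′ x<j j<k k<l kl (ℕ.<-trans li ix) xj
  ... | inj₂ ix | inj₂ jx = 321⇒ℓT<ℓS w (x , j , k , x<j , j<k , jx , ℕ.<-trans kl (ℕ.<-trans li ij))
  ... | inj₁ xi | _ = ℓT<ℓS-descent w i<x xi
    (3412⇒ℓT<ℓS′ g _ le′ x<j j<k k<l
      (subst₂ _<_ (sym (away j<k)) (sym (away (ℕ.<-trans j<k k<l))) kl)
      (subst₂ _<_ (sym (away (ℕ.<-trans j<k k<l))) (sym (at-right w i x)) li)
      (subst₂ _<_ (sym (at-right w i x)) (sym w′j) ij))
    where
    w′j : (i , x) · w ⟨$⟩ʳ j ≡ w ⟨$⟩ʳ j
    w′j = at-other w i x (>⇒≢ i<j) (>⇒≢ x<j)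
    away : ∀ {m} → j < m → (i , x) · w ⟨$⟩ʳ m ≡ w ⟨$⟩ʳ m
    away j<m = at-other w i x (>⇒≢ (ℕ.<-trans i<j j<m)) (>⇒≢ (ℕ.<-trans x<j j<m))
... | yes _ | no k≢y | _ = shrink
  where
  k<y = predecessor-< {i = k} adjy k<l k≢y
  y<l = adjacent⇒< {i = y} adjy
  le′ : toℕ y + toℕ k ≤ toℕ i + toℕ j + g
  le′ = ℕ.≤-pred (ℕ.≤-trans (ℕ.≤-reflexive (cong (_+ toℕ k) (sym adjy)))
          (ℕ.≤-trans le (ℕ.≤-reflexive (ℕ.+-suc _ g))))
  shrink : ℓT w ℕ.< ℓS w
  shrink with value-cmp w {y} {l} (<⇒≢ y<l) | value-cmp w {y} {k} (>⇒≢ k<y)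
  ... | inj₁ yl | inj₂ ky = 3412⇒ℓT<ℓS′ g w le′ i<j j<k k<y ky (ℕ.<-trans yl li) ij
  ... | inj₁ yl | inj₁ yk = 321⇒ℓT<ℓS w (j , k , y , j<k , k<y , ℕ.<-trans kl (ℕ.<-trans li ij) , yk)
  ... | inj₂ ly | _ = ℓT<ℓS-descent w y<l ly
    (3412⇒ℓT<ℓS′ g _ le′ i<j j<k k<y
      (subst₂ _<_ (sym w′k) (sym (at-left w y l)) kl)
      (subst₂ _<_ (sym (at-left w y l)) (sym (away (ℕ.<-trans i<j j<k))) li)
      (subst₂ _<_ (sym (away (ℕ.<-trans i<j j<k))) (sym (away j<k)) ij))
    where
    w′k : (y , l) · w ⟨$⟩ʳ k ≡ w ⟨$⟩ʳ k
    w′k = at-other w y l k≢y (<⇒≢ k<l)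
    away : ∀ {m} → m < k → (y , l) · w ⟨$⟩ʳ m ≡ w ⟨$⟩ʳ m
    away m<k = at-other w y l (<⇒≢ (ℕ.<-trans m<k k<y)) (<⇒≢ (ℕ.<-trans m<k k<l))
... | yes _ | yes _ | no z≢k = shrink
  where
  z<k = successor-< {j = k} adjz j<k z≢k
  j<z = adjacent⇒< {i = j} adjz
  i<z = ℕ.<-trans i<j j<z
  le′ : toℕ l + toℕ k ≤ toℕ i + toℕ z + g
  le′ = ℕ.≤-trans le (ℕ.≤-reflexive (trans (ℕ.+-suc _ g)
          (cong (_+ g) (trans (sym (ℕ.+-suc (toℕ i) _)) (cong (toℕ i +_) (sym adjz))))))
  shrink : ℓT w ℕ.< ℓS w
  shrink with value-cmp w {z} {j} (>⇒≢ j<z)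
  -- The 4 of the pattern has no upper bound, so a larger value at z replaces it and no 321 has to
  -- be considered.
  ... | inj₂ jz = 3412⇒ℓT<ℓS′ g w le′ i<z z<k k<l kl li (ℕ.<-trans ij jz)
  ... | inj₁ zj = ℓT<ℓS-descent w j<z zj
    (3412⇒ℓT<ℓS′ g _ le′ i<z z<k k<l
      (subst₂ _<_ (sym (away z<k)) (sym (away (ℕ.<-trans z<k k<l))) kl)
      (subst₂ _<_ (sym (away (ℕ.<-trans z<k k<l))) (sym w′i) li)
      (subst₂ _<_ (sym w′i) (sym (at-right w j z)) ij))
    where
    w′i : (j , z) · w ⟨$⟩ʳ i ≡ w ⟨$⟩ʳ i
    w′i = at-other w j z (<⇒≢ i<j) (<⇒≢ i<z)
    away : ∀ {m} → z < m → (j , z) · w ⟨$⟩ʳ m ≡ w ⟨$⟩ʳ m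
    away z<m = at-other w j z (>⇒≢ (ℕ.<-trans j<z z<m)) (>⇒≢ z<m)

3412⇒ℓT<ℓS : (w : Permutation′ n) → Has3412 w → ℓT w ℕ.< ℓS w
3412⇒ℓT<ℓS w (i , j , k , l , i<j , j<k , k<l , kl , li , ij) =
  3412⇒ℓT<ℓS′ (toℕ l + toℕ k) w (ℕ.m≤n+m _ (toℕ i + toℕ j)) i<j j<k k<l kl li ij

-- The total excess

sum-mono-≤ : {f g : Fin n → ℕ} → (∀ i → f i ≤ g i) → sum f ≤ sum g
sum-mono-≤ {zero}  le = z≤n
sum-mono-≤ {suc n} le = ℕ.+-mono-≤ (le zero) (sum-mono-≤ (le ∘ suc))

sum-mono-< : {f g : Fin n → ℕ} → (∀ i → f i ≤ g i) → ∀ i → f i ℕ.< g i → sum f ℕ.< sum g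
sum-mono-< le zero    lt = ℕ.+-mono-<-≤ lt (sum-mono-≤ (le ∘ suc))
sum-mono-< le (suc i) lt = ℕ.+-mono-≤-< (le zero) (sum-mono-< (le ∘ suc) i lt)

sum-0 : {f : Fin n → ℕ} → (∀ i → f i ≡ 0) → sum f ≡ 0
sum-0 {zero}  f≡0 = refl
sum-0 {suc n} f≡0 = cong₂ _+_ (f≡0 zero) (sum-0 (f≡0 ∘ suc))

sum-single : {f : Fin n → ℕ} → ∀ i → (∀ {j} → j ≢ i → f j ≡ 0) → sum f ≡ f i
sum-single {f = f} zero    f≡0 =
  trans (cong (f zero +_) (sum-0 {f = f ∘ suc} λ j → f≡0 {suc j} λ ())) (ℕ.+-identityʳ _)
sum-single {f = f} (suc i) f≡0 =
  cong₂ _+_ (f≡0 {zero} λ ()) (sum-single {f = f ∘ suc} i λ j≢i → f≡0 (j≢i ∘ Fin.suc-injective))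

∸-triangle : ∀ m n o → m ∸ o ≤ (m ∸ n) + (n ∸ o)
∸-triangle m n o = ℕ.m≤n+o⇒m∸n≤o m o (begin
  m                         ≤⟨ ℕ.m≤n+m∸n m n ⟩
  n + (m ∸ n)               ≤⟨ ℕ.+-monoˡ-≤ (m ∸ n) (ℕ.m≤n+m∸n n o) ⟩
  o + (n ∸ o) + (m ∸ n)     ≡⟨ ℕ.+-assoc o _ _ ⟩
  o + ((n ∸ o) + (m ∸ n))   ≡⟨ cong (o +_) (ℕ.+-comm (n ∸ o) _) ⟩
  o + ((m ∸ n) + (n ∸ o))   ∎)
  where open ℕ.≤-Reasoning

-- Truncated subtraction keeps only the points that move up; the sum is half the total displacement.
excess : Permutation′ n → ℕ
excess w = sum (λ i → toℕ (w ⟨$⟩ʳ i) ∸ toℕ i)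

excess-transpose : {i j : Fin n} → i < j → excess (Perm.transpose i j) ≡ depth (i , j)
excess-transpose {i = i} {j} i<j =
  trans (sum-single i vanishes) (cong (λ y → toℕ y ∸ toℕ i) (transpose-matchˡ i j))
  where
  vanishes : ∀ {k} → k ≢ i → toℕ (transpose i j k) ∸ toℕ k ≡ 0
  vanishes {k} k≢i with transposeView i j k
  ... | left        = contradiction refl k≢i
  ... | right       = trans (cong (λ y → toℕ y ∸ toℕ j) (transpose-matchʳ i j))
                        (ℕ.m≤n⇒m∸n≡0 (ℕ.<⇒≤ i<j))
  ... | other _ k≢j = trans (cong (λ y → toℕ y ∸ toℕ k) (transpose-mismatch i j k≢i k≢j))
                        (ℕ.n∸n≡0 (toℕ k))

-- The triangle inequality is applied at the intermediate point v(i), and one of the two sums is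
-- reindexed by v.
excess-∘ : (v w : Permutation′ n) → excess (v ∘ₚ w) ≤ excess w + excess v
excess-∘ v w = begin
  excess (v ∘ₚ w)
    ≤⟨ sum-mono-≤ (λ i → ∸-triangle (toℕ (w ⟨$⟩ʳ (v ⟨$⟩ʳ i))) (toℕ (v ⟨$⟩ʳ i)) (toℕ i)) ⟩
  sum (λ i → f (v ⟨$⟩ʳ i) + (toℕ (v ⟨$⟩ʳ i) ∸ toℕ i))
    ≡⟨ ∑-distrib-+ (λ i → f (v ⟨$⟩ʳ i)) (λ i → toℕ (v ⟨$⟩ʳ i) ∸ toℕ i) ⟩
  sum (λ i → f (v ⟨$⟩ʳ i)) + excess v
    ≡⟨ cong (_+ excess v) (sum-permute f v) ⟨
  excess w + excess v ∎
  where
  open ℕ.≤-Reasoning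
  f = λ i → toℕ (w ⟨$⟩ʳ i) ∸ toℕ i

excess-eval : {ts : TranspositionList n} → All IsTransposition ts → excess (eval ts) ≤ TotalDepth ts
excess-eval {n} [] = ℕ.≤-reflexive (sum-0 {n} {λ i → toℕ i ∸ toℕ i} λ i → ℕ.n∸n≡0 (toℕ i))
excess-eval {ts = (i , j) ∷ ts} (p ∷ ps) = begin
  excess (eval ((i , j) ∷ ts))                      ≤⟨ excess-∘ (Perm.transpose i j) (eval ts) ⟩
  excess (eval ts) + excess (Perm.transpose i j)    ≡⟨ cong (excess (eval ts) +_) (excess-transpose p) ⟩
  excess (eval ts) + depth (i , j)                  ≡⟨ ℕ.+-comm (excess (eval ts)) _ ⟩
  depth (i , j) + excess (eval ts)                  ≤⟨ ℕ.+-monoʳ-≤ (depth (i , j)) (excess-eval ps) ⟩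
  depth (i , j) + TotalDepth ts                     ∎
  where open ℕ.≤-Reasoning

excess≤dp : (w : Permutation′ n) → excess w ≤ dp w
excess≤dp w with dp-word w
... | ts , ok , eq , len = ℕ.≤-trans
  (ℕ.≤-reflexive (sum-cong-≗ λ i → cong (λ y → toℕ y ∸ toℕ i) (sym (eq i))))
  (ℕ.≤-trans (excess-eval ok) (ℕ.≤-reflexive len))

-- After reindexing, the values stay and the positions p and q are exchanged. The term of w(p) > p
-- drops by one, and the term of w(q) ≤ p remains zero.
excess-descent : (w : Permutation′ n) {p q : Fin n} → IsAdjacent (p , q) →
                 p < (w ⟨$⟩ʳ p) → toℕ (w ⟨$⟩ʳ q) ≤ toℕ p → excess ((p , q) · w) ℕ.< excess w
excess-descent w {p} {q} adj p<wp wq≤p = begin-strict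
  excess ((p , q) · w)
    ≡⟨ sum-cong-≗ (λ i → cong (λ y → toℕ (w ⟨$⟩ʳ transpose p q i) ∸ toℕ y) (transpose-involutive p q i)) ⟨
  sum (λ i → f (transpose p q i))
    ≡⟨ sum-permute f (Perm.transpose p q) ⟨
  sum f
    <⟨ sum-mono-< f≤ p f<  ⟩
  excess w ∎
  where
  open ℕ.≤-Reasoning
  f = λ i → toℕ (w ⟨$⟩ʳ i) ∸ toℕ (transpose p q i)
  f< : f p ℕ.< toℕ (w ⟨$⟩ʳ p) ∸ toℕ p
  f< rewrite transpose-matchˡ p q | adj = ℕ.∸-monoʳ-< (ℕ.n<1+n (toℕ p)) p<wp
  f≤ : ∀ i → f i ≤ toℕ (w ⟨$⟩ʳ i) ∸ toℕ i
  f≤ i with transposeView p q i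
  ... | left  = ℕ.<⇒≤ f<
  ... | right rewrite transpose-matchʳ p q | ℕ.m≤n⇒m∸n≡0 wq≤p = z≤n
  ... | other i≢p i≢q rewrite transpose-mismatch p q i≢p i≢q = ℕ.≤-refl

-- The first moved point

FixesBelow : Permutation′ n → Fin n → Set
FixesBelow w x = ∀ {y} → y < x → w ⟨$⟩ʳ y ≡ y

first-moved : (w : Permutation′ n) →
              w ≈ Perm.id ⊎ ∃ λ x → w ⟨$⟩ʳ x ≢ x × FixesBelow w x
first-moved {n} w with Fin.all? (λ x → (w ⟨$⟩ʳ x) ≟ x)
... | yes fixed = inj₁ fixed
... | no moved with Fin.¬∀⟶∃¬-smallest n (λ x → w ⟨$⟩ʳ x ≡ x) (λ x → (w ⟨$⟩ʳ x) ≟ x) moved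
...   | x , wx≢x , fixed = inj₂ (x , wx≢x , λ y<x → subst (λ y → w ⟨$⟩ʳ y ≡ y)
          (toℕ-injective (trans (Fin.toℕ-inject (fromℕ< y<x)) (Fin.toℕ-fromℕ< y<x)))
          (fixed (fromℕ< y<x)))

module FirstMoved (w : Permutation′ n) {x : Fin n} (wx≢x : w ⟨$⟩ʳ x ≢ x) (fixed : FixesBelow w x) where

  -- The values below x are already taken by the positions below x.
  preserves-≥ : ∀ {y} → toℕ x ≤ toℕ y → toℕ x ≤ toℕ (w ⟨$⟩ʳ y)
  preserves-≥ {y} x≤y with (w ⟨$⟩ʳ y) Fin.<? x
  ... | no wy≮x  = ℕ.≮⇒≥ wy≮x
  ... | yes wy<x = contradiction
    (subst (_< x) (⟨$⟩ʳ-injective w (fixed wy<x)) wy<x) (ℕ.≤⇒≯ x≤y)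

  x<wx : x < (w ⟨$⟩ʳ x)
  x<wx = ℕ.≤∧≢⇒< (preserves-≥ ℕ.≤-refl) (λ eq → wx≢x (sym (toℕ-injective eq)))

  b : Fin n
  b = w ⟨$⟩ˡ x

  wb≡x : w ⟨$⟩ʳ b ≡ x
  wb≡x = inverseʳ w

  x<b : x < b
  x<b with Fin.<-cmp x b
  ... | tri< lt _ _ = lt
  ... | tri≈ _ eq _ = contradiction (trans (cong (w ⟨$⟩ʳ_) eq) wb≡x) wx≢x
  ... | tri> _ _ gt = contradiction (trans (sym (fixed gt)) wb≡x) (<⇒≢ gt)

  x<w : ∀ {y} → x < y → y ≢ b → x < (w ⟨$⟩ʳ y)
  x<w x<y y≢b = ℕ.≤∧≢⇒< (preserves-≥ (ℕ.<⇒≤ x<y))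
    (λ eq → y≢b (⟨$⟩ʳ-injective w (trans (sym (toℕ-injective eq)) (sym wb≡x))))

  -- The values at x, …, b − 1 increase, since each exceeds the later value x.
  exceeds : ¬ Has321 w → ∀ g {y} → toℕ y ≤ toℕ x + g → toℕ x ≤ toℕ y → y < b → y < (w ⟨$⟩ʳ y)
  exceeds avoids g {y} le x≤y y<b with x ≟ y
  ... | yes refl = x<wx
  exceeds avoids zero {y} le x≤y y<b | no x≢y =
    contradiction (toℕ-injective (ℕ.≤-antisym x≤y (ℕ.≤-trans le (ℕ.≤-reflexive (ℕ.+-identityʳ _))))) x≢y
  exceeds avoids (suc g) {y} le x≤y y<b | no x≢y
    with y′ , adj ← predecessor (ℕ.≤∧≢⇒< x≤y (x≢y ∘ toℕ-injective))
    with value-cmp w {y} {y′} (>⇒≢ (adjacent⇒< {i = y′} adj))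
  ... | inj₁ descent = contradiction
        (y′ , y , b , adjacent⇒< {i = y′} adj , y<b , descent ,
          subst (_< (w ⟨$⟩ʳ y)) (sym wb≡x) (x<w (ℕ.≤∧≢⇒< x≤y (x≢y ∘ toℕ-injective)) (<⇒≢ y<b)))
        avoids
  ... | inj₂ ascent = ℕ.≤-<-trans (ℕ.≤-trans (ℕ.≤-reflexive adj)
          (exceeds avoids g
            (ℕ.≤-pred (ℕ.≤-trans (ℕ.≤-reflexive (sym adj)) (ℕ.≤-trans le (ℕ.≤-reflexive (ℕ.+-suc _ g)))))
            (ℕ.≤-pred (ℕ.≤-trans (ℕ.≤∧≢⇒< x≤y (x≢y ∘ toℕ-injective)) (ℕ.≤-reflexive adj)))
            (ℕ.<-trans (adjacent⇒< {i = y′} adj) y<b)))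
          ascent

-- The transposition carries the three positions over and keeps their order: the only pair it
-- reverses is p, q, which is no inversion once the descent has been undone.
321-ascent : (w : Permutation′ n) {p q : Fin n} → IsAdjacent (p , q) → (w ⟨$⟩ʳ q) < (w ⟨$⟩ʳ p) →
             Has321 ((p , q) · w) → Has321 w
321-ascent w {p} {q} adj inv (i , j , k , i<j , j<k , ji , kj) =
  transpose p q i , transpose p q j , transpose p q k , keep i<j ji , keep j<k kj , ji , kj
  where
  keep : ∀ {i j} → i < j → ((p , q) · w ⟨$⟩ʳ j) < ((p , q) · w ⟨$⟩ʳ i) →
         transpose p q i < transpose p q j
  keep i<j ji = adjacent-transpose-< adj i<j λ { (refl , refl) →
    contradiction (subst₂ _<_ (at-right w p q) (at-left w p q) ji) (ℕ.<-asym inv) }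

ℓS-id : (w : Permutation′ n) → w ≈ Perm.id → ℓS w ≡ 0
ℓS-id w w≈id = ℕ.n≤0⇒n≡0 (ℓS≤length {ts = []} [] (λ x → sym (w≈id x)))

-- By induction on the bound `g`: each adjacent letter undone costs one in ℓS and gains at least one
-- in the excess, while 321 stays avoided.
ℓS≤excess : ∀ g (w : Permutation′ n) → excess w ≤ g → ¬ Has321 w → ℓS w ≤ excess w
ℓS≤excess g w le avoids with first-moved w
... | inj₁ w≈id = ℕ.≤-trans (ℕ.≤-reflexive (ℓS-id w w≈id)) z≤n
... | inj₂ (x , wx≢x , fixed) with predecessor (FirstMoved.x<b w wx≢x fixed)
...   | p , adj = go g le
  where
  open FirstMoved w wx≢x fixed
  w′ = (p , b) · w
  x≤p : toℕ x ≤ toℕ p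
  x≤p = ℕ.≤-pred (ℕ.≤-trans x<b (ℕ.≤-reflexive adj))
  p<wp : p < (w ⟨$⟩ʳ p)
  p<wp = exceeds avoids (toℕ p) (ℕ.m≤n+m _ _) x≤p (adjacent⇒< {i = p} adj)
  wb≤p : toℕ (w ⟨$⟩ʳ b) ≤ toℕ p
  wb≤p = ℕ.≤-trans (ℕ.≤-reflexive (cong toℕ wb≡x)) x≤p
  smaller : excess w′ ℕ.< excess w
  smaller = excess-descent w adj p<wp wb≤p
  -- The bound is split only here, where the strict decrease is at hand to refute a zero bound.
  go : ∀ g → excess w ≤ g → ℓS w ≤ excess w
  go zero    le = contradiction (ℕ.<-≤-trans smaller le) λ ()
  go (suc g) le = ℕ.≤-trans (ℓS-step w {p , b} adj)
    (ℕ.≤-trans (s≤s (ℓS≤excess g w′ (ℕ.≤-pred (ℕ.≤-trans smaller le))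
      (avoids ∘ 321-ascent w adj (ℕ.≤-<-trans wb≤p p<wp)))) smaller)

ℓS≤dp : (w : Permutation′ n) → ¬ Has321 w → ℓS w ≤ dp w
ℓS≤dp w avoids = ℕ.≤-trans (ℓS≤excess (excess w) w ℕ.≤-refl avoids) (excess≤dp w)

-- Permutations avoiding 321 and 3412

FixesThrough : Permutation′ n → Fin n → Set
FixesThrough w x = ∀ {y} → toℕ y ≤ toℕ x → w ⟨$⟩ʳ y ≡ y

-- If j ≤ x, then w(k) < w(j) = j is itself a fixed point, so k = w(k) < j, against j < k.
inversion-beyond : (w : Permutation′ n) {x j k : Fin n} → FixesThrough w x → j < k →
                   (w ⟨$⟩ʳ k) < (w ⟨$⟩ʳ j) → x < j
inversion-beyond w {x} {j} {k} fixed j<k inv with x Fin.<? j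
... | yes x<j = x<j
... | no x≮j  = contradiction j<k (ℕ.<-asym k<j)
  where
  j≤x = ℕ.≮⇒≥ x≮j
  wk<j : (w ⟨$⟩ʳ k) < j
  wk<j = subst ((w ⟨$⟩ʳ k) <_) (fixed j≤x) inv
  k<j : k < j
  k<j = subst (_< j) (⟨$⟩ʳ-injective w (fixed (ℕ.≤-trans (ℕ.<⇒≤ wk<j) j≤x))) wk<j

module _ (w : Permutation′ n) {x : Fin n} (wx≢x : w ⟨$⟩ʳ x ≢ x) (fixed : FixesBelow w x)
         {s : Fin n} (adj : IsAdjacent (x , s)) where

  open FirstMoved w wx≢x fixed

  private
    x<s : x < s
    x<s = adjacent⇒< adj

  -- Otherwise the values x and s occur at later positions b and d. If w(s) < w(x), then x, s, b is
  -- a 321. If not, x, s, b, d is a 3412 when b < d, and x, d, b is a 321 when d < b.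
  first-moved-adjacent : ¬ Has321 w → ¬ Has3412 w → w ⟨$⟩ʳ x ≡ s ⊎ w ⟨$⟩ʳ s ≡ x
  first-moved-adjacent avoids₁ avoids₂ with (w ⟨$⟩ʳ x) ≟ s | s ≟ b
  ... | yes wx≡s | _       = inj₁ wx≡s
  ... | no _     | yes s≡b = inj₂ (trans (cong (w ⟨$⟩ʳ_) s≡b) wb≡x)
  ... | no wx≢s  | no s≢b  = ⊥-elim contra
    where
    s<wx = successor-< {j = w ⟨$⟩ʳ x} adj x<wx (wx≢s ∘ sym)
    s<b = successor-< {j = b} adj x<b s≢b
    d = w ⟨$⟩ˡ s
    wd≡s : w ⟨$⟩ʳ d ≡ s
    wd≡s = inverseʳ w
    x<d : x < d
    x<d with Fin.<-cmp x d
    ... | tri< lt _ _ = lt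
    ... | tri≈ _ eq _ = contradiction (trans (cong (w ⟨$⟩ʳ_) eq) wd≡s) wx≢s
    ... | tri> _ _ gt = contradiction (trans (sym (fixed gt)) wd≡s) (<⇒≢ (ℕ.<-trans gt x<s))
    contra : ⊥
    contra with value-cmp w {s} {x} (>⇒≢ x<s)
    ... | inj₁ lt = avoids₁ (x , s , b , x<s , s<b , lt , subst (_< (w ⟨$⟩ʳ s)) (sym wb≡x) (x<w x<s s≢b))
    ... | inj₂ gt with Fin.<-cmp b d
    ...   | tri< b<d _ _ = avoids₂ (x , s , b , d , x<s , s<b , b<d ,
              subst₂ _<_ (sym wb≡x) (sym wd≡s) x<s , subst (_< (w ⟨$⟩ʳ x)) (sym wd≡s) s<wx , gt)
    ...   | tri≈ _ b≡d _ = <⇒≢ x<s (trans (sym wb≡x) (trans (cong (w ⟨$⟩ʳ_) b≡d) wd≡s))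
    ...   | tri> _ _ d<b = avoids₁ (x , d , b , x<d , d<b ,
              subst (_< (w ⟨$⟩ʳ x)) (sym wd≡s) s<wx , subst₂ _<_ (sym wb≡x) (sym wd≡s) x<s)

  module SwapValues (wx≡s : w ⟨$⟩ʳ x ≡ s) where

    w′ : Permutation′ n
    w′ = w ∘ₚ Perm.transpose x s

    w′x≡x : w′ ⟨$⟩ʳ x ≡ x
    w′x≡x = trans (cong (transpose x s) wx≡s) (transpose-matchʳ x s)

    fixes : FixesThrough w′ x
    fixes {y} y≤x with ℕ.m≤n⇒m<n∨m≡n y≤x
    ... | inj₁ y<x = trans (cong (transpose x s) (fixed y<x))
        (transpose-mismatch x s (<⇒≢ y<x) (<⇒≢ (ℕ.<-trans y<x x<s)))
    ... | inj₂ y≡x rewrite toℕ-injective y≡x = w′x≡x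

    -- Exchanging the values x and s reverses only this pair, and in `w′` the value x sits at the
    -- excluded position x.
    reflects-< : ∀ {u v} → u ≢ x → (w′ ⟨$⟩ʳ u) < (w′ ⟨$⟩ʳ v) → (w ⟨$⟩ʳ u) < (w ⟨$⟩ʳ v)
    reflects-< {u} u≢x lt = subst₂ _<_ (transpose-involutive x s _) (transpose-involutive x s _)
      (adjacent-transpose-< adj lt λ (w′u≡x , _) → u≢x (⟨$⟩ʳ-injective w′ (trans w′u≡x (sym w′x≡x))))

    321-back : Has321 w′ → Has321 w
    321-back (i , j , k , i<j , j<k , ji , kj) =
      i , j , k , i<j , j<k , reflects-< (>⇒≢ x<j) ji , reflects-< (>⇒≢ (ℕ.<-trans x<j j<k)) kj
      where x<j = inversion-beyond w′ fixes j<k kj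

    3412-back : Has3412 w′ → Has3412 w
    3412-back (i , j , k , l , i<j , j<k , k<l , kl , li , ij) =
      i , j , k , l , i<j , j<k , k<l ,
      reflects-< (>⇒≢ (ℕ.<-trans x<j j<k)) kl , reflects-< (>⇒≢ (ℕ.<-trans x<j (ℕ.<-trans j<k k<l))) li ,
      reflects-< (>⇒≢ x<i) ij
      where
      x<i = inversion-beyond w′ fixes (ℕ.<-trans i<j j<k) (ℕ.<-trans kl li)
      x<j = ℕ.<-trans x<i i<j

  module SwapPositions (ws≡x : w ⟨$⟩ʳ s ≡ x) where

    w′ : Permutation′ n
    w′ = (x , s) · w

    w′x≡x : w′ ⟨$⟩ʳ x ≡ x
    w′x≡x = trans (at-left w x s) ws≡x

    fixes : FixesThrough w′ x
    fixes {y} y≤x with ℕ.m≤n⇒m<n∨m≡n y≤x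
    ... | inj₁ y<x = trans (at-other w x s (<⇒≢ y<x) (<⇒≢ (ℕ.<-trans y<x x<s))) (fixed y<x)
    ... | inj₂ y≡x rewrite toℕ-injective y≡x = w′x≡x

    321-back : Has321 w′ → Has321 w
    321-back = 321-ascent w adj (subst (_< (w ⟨$⟩ʳ x)) (sym ws≡x) x<wx)

    -- The whole occurrence lies beyond x, so the exchanged positions x and s are not both used and
    -- the order is kept.
    3412-back : Has3412 w′ → Has3412 w
    3412-back (i , j , k , l , i<j , j<k , k<l , kl , li , ij) =
      transpose x s i , transpose x s j , transpose x s k , transpose x s l ,
      keep x<i i<j , keep (ℕ.<-trans x<i i<j) j<k , keep (ℕ.<-trans x<i (ℕ.<-trans i<j j<k)) k<l ,
      kl , li , ij
      where
      x<i = inversion-beyond w′ fixes (ℕ.<-trans i<j j<k) (ℕ.<-trans kl li)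
      keep : ∀ {u v} → x < u → u < v → transpose x s u < transpose x s v
      keep x<u u<v = adjacent-transpose-< adj u<v λ (u≡x , _) → >⇒≢ x<u u≡x

-- The letter undone is adjacent, which costs at most one in ℓS, and joins a point to its image,
-- which gains at least one in ℓT.
ℓS≤ℓT′ : ∀ g (w : Permutation′ n) → ℓT w ≤ g → ¬ Has321 w → ¬ Has3412 w → ℓS w ≤ ℓT w
ℓS≤ℓT′ g w le avoids₁ avoids₂ with first-moved w
... | inj₁ w≈id = ℕ.≤-trans (ℕ.≤-reflexive (ℓS-id w w≈id)) z≤n
... | inj₂ (x , wx≢x , fixed) with s , adj ← successor (FirstMoved.x<wx w wx≢x fixed)
  with first-moved-adjacent w wx≢x fixed adj avoids₁ avoids₂
...   | inj₁ wx≡s = go g le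
  where
  open SwapValues w wx≢x fixed adj wx≡s
  smaller : suc (ℓT w′) ≤ ℓT w
  smaller = ℓT-splitʳ w wx≡s (<⇒≢ (adjacent⇒< {i = x} adj))
  go : ∀ g → ℓT w ≤ g → ℓS w ≤ ℓT w
  go zero    le = contradiction (ℕ.<-≤-trans smaller le) λ ()
  go (suc g) le = ℕ.≤-trans (ℓS-stepʳ w adj) (ℕ.≤-trans (s≤s (ℓS≤ℓT′ g w′
    (ℕ.≤-pred (ℕ.≤-trans smaller le)) (avoids₁ ∘ 321-back) (avoids₂ ∘ 3412-back))) smaller)
...   | inj₂ ws≡x = go g le
  where
  open SwapPositions w wx≢x fixed adj ws≡x
  smaller : suc (ℓT w′) ≤ ℓT w
  -- `ℓT-split` takes the point first and its image second, hence the flipped letter (s , x).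
  smaller = ℕ.≤-trans
    (s≤s (ℓT-cong {w = (s , x) · w} λ z → cong (w ⟨$⟩ʳ_) (transpose-comm x s z)))
    (ℓT-split w ws≡x (>⇒≢ (adjacent⇒< {i = x} adj)))
  go : ∀ g → ℓT w ≤ g → ℓS w ≤ ℓT w
  go zero    le = contradiction (ℕ.<-≤-trans smaller le) λ ()
  go (suc g) le = ℕ.≤-trans (ℓS-step w {x , s} adj) (ℕ.≤-trans (s≤s (ℓS≤ℓT′ g w′
    (ℕ.≤-pred (ℕ.≤-trans smaller le)) (avoids₁ ∘ 321-back) (avoids₂ ∘ 3412-back))) smaller)

ℓS≤ℓT : (w : Permutation′ n) → ¬ Has321 w → ¬ Has3412 w → ℓS w ≤ ℓT w
ℓS≤ℓT w = ℓS≤ℓT′ (ℓT w) w ℕ.≤-refl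

-- The two characterisations

dp≡ℓS⇔ : (w : Permutation′ n) → (dp w ≡ ℓS w) ⇔ (¬ Has321 w)
dp≡ℓS⇔ w = mk⇔ (λ eq p → ℕ.<⇒≢ (321⇒dp<ℓS w p) eq)
  (λ avoids → ℕ.≤-antisym (dp≤ℓS w) (ℓS≤dp w avoids))

-- Equality of ℓT and dp extends to ℓS, which either pattern would make strictly larger than ℓT.
-- Conversely ℓT ≤ dp ≤ ℓS ≤ ℓT.
ℓT≡dp⇔ : (w : Permutation′ n) → (ℓT w ≡ dp w) ⇔ (¬ Has321 w × ¬ Has3412 w)
ℓT≡dp⇔ w = mk⇔
  (λ eq → let dp≡ℓS = ℓT≡dp⇒dp≡ℓS w eq in
    (λ p → ℕ.<⇒≢ (321⇒ℓT<ℓS w p) (trans eq dp≡ℓS)) ,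
    (λ p → ℕ.<⇒≢ (3412⇒ℓT<ℓS w p) (trans eq dp≡ℓS)))
  (λ (avoids₁ , avoids₂) → ℕ.≤-antisym (ℓT≤dp w)
    (ℕ.≤-trans (dp≤ℓS w) (ℓS≤ℓT w avoids₁ avoids₂)))

-- Pattern containment as explicit inequalities

increasing : ∀ {k} (g : Fin (suc k) → Fin n) → (∀ a → g (inject₁ a) < g (suc a)) →
             ∀ {a b} → a < b → g a < g b
increasing {k = suc k} g step {zero}  {suc zero}    _        = step zero
increasing {k = suc k} g step {zero}  {suc (suc b)} _        =
  ℕ.<-trans (step zero) (increasing (g ∘ suc) (step ∘ suc) {zero} {suc b} (s≤s z≤n))
increasing {k = suc k} g step {suc a} {suc b}       (s≤s lt) = increasing (g ∘ suc) (step ∘ suc) lt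

-- Neighbours suffice, both in the order of positions and in the order of values; `p ⟨$⟩ˡ_` lists
-- the positions of the pattern by increasing value.
contains : ∀ {k} (w : Permutation′ n) (p : Permutation′ (suc k)) (i : Fin (suc k) → Fin n) →
           (∀ a → i (inject₁ a) < i (suc a)) →
           (∀ a → (w ⟨$⟩ʳ i (p ⟨$⟩ˡ inject₁ a)) < (w ⟨$⟩ʳ i (p ⟨$⟩ˡ suc a))) →
           Contains w p
contains w p i positions values =
  i , (λ _ _ → increasing i positions) , λ a b → mk⇔ (to a b) (from a b)
  where
  f = λ a → w ⟨$⟩ʳ i a
  from : ∀ a b → (p ⟨$⟩ʳ a) < (p ⟨$⟩ʳ b) → f a < f b
  from a b lt = subst₂ (λ a b → f a < f b) (inverseˡ p) (inverseˡ p)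
                  (increasing (λ a → f (p ⟨$⟩ˡ a)) values lt)
  to : ∀ a b → f a < f b → (p ⟨$⟩ʳ a) < (p ⟨$⟩ʳ b)
  to a b lt with Fin.<-cmp (p ⟨$⟩ʳ a) (p ⟨$⟩ʳ b)
  ... | tri< pa<pb _ _ = pa<pb
  ... | tri≈ _ pa≡pb _ = contradiction (cong f (⟨$⟩ʳ-injective p pa≡pb)) (<⇒≢ lt)
  ... | tri> _ _ pb<pa = contradiction (from b a pb<pa) (ℕ.<-asym lt)

contains-321⇔ : (w : Permutation′ n) → Contains w p321 ⇔ Has321 w
contains-321⇔ w = mk⇔
  (λ (i , positions , values) → i 0F , i 1F , i 2F ,
    positions 0F 1F (s≤s z≤n) , positions 1F 2F (s≤s (s≤s z≤n)) ,
    Equivalence.from (values 1F 0F) (s≤s (s≤s z≤n)) , Equivalence.from (values 2F 1F) (s≤s z≤n))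
  (λ (i , j , k , i<j , j<k , ji , kj) → contains w p321 (lookup (i ∷ j ∷ k ∷ []))
    (λ { 0F → i<j ; 1F → j<k }) (λ { 0F → kj ; 1F → ji }))

contains-3412⇔ : (w : Permutation′ n) → Contains w p3412 ⇔ Has3412 w
contains-3412⇔ w = mk⇔
  (λ (i , positions , values) → i 0F , i 1F , i 2F , i 3F ,
    positions 0F 1F (s≤s z≤n) , positions 1F 2F (s≤s (s≤s z≤n)) , positions 2F 3F (s≤s (s≤s (s≤s z≤n))) ,
    Equivalence.from (values 2F 3F) (s≤s z≤n) , Equivalence.from (values 3F 0F) (s≤s (s≤s z≤n)) ,
    Equivalence.from (values 0F 1F) (s≤s (s≤s (s≤s z≤n))))
  (λ (i , j , k , l , i<j , j<k , k<l , kl , li , ij) → contains w p3412 (lookup (i ∷ j ∷ k ∷ l ∷ []))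
    (λ { 0F → i<j ; 1F → j<k ; 2F → k<l }) (λ { 0F → kl ; 1F → li ; 2F → ij }))

Has321-resp : (v w : Permutation′ n) → v ≈ w → Has321 v → Has321 w
Has321-resp v w v≈w (i , j , k , i<j , j<k , ji , kj) =
  i , j , k , i<j , j<k , subst₂ _<_ (v≈w j) (v≈w i) ji , subst₂ _<_ (v≈w k) (v≈w j) kj

Has3412-resp : (v w : Permutation′ n) → v ≈ w → Has3412 v → Has3412 w
Has3412-resp v w v≈w (i , j , k , l , i<j , j<k , k<l , kl , li , ij) =
  i , j , k , l , i<j , j<k , k<l ,
  subst₂ _<_ (v≈w k) (v≈w l) kl , subst₂ _<_ (v≈w l) (v≈w i) li , subst₂ _<_ (v≈w i) (v≈w j) ij

-- Enumerations

-- The index set carries plain equality while permutations are compared as functions, so that sums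
-- and insertions need no quotient.
record Enumeration (P : Pred (Permutation′ n) 0ℓ) (c : ℕ) : Set₁ where
  field
    Index      : Set
    Index↔Fin  : Index ↔ Fin c
    perm       : Index → Permutation′ n
    satisfies  : ∀ x → P (perm x)
    injective  : ∀ {x y} → perm x ≈ perm y → x ≡ y
    surjective : ∀ w → P w → ∃ λ x → perm x ≈ w

module _ {P : Pred (Permutation′ n) 0ℓ} where

  open Enumeration

  enumeration⇒cardinality : ∀ {c} → Enumeration P c → HasCardinality (PermutationsWith P) c
  enumeration⇒cardinality e = record
    { to        = λ (w , p) → to (proj₁ (surjective e w p))
    ; from      = λ i → perm e (from i) , satisfies e (from i)
    ; to-cong   = λ {(v , p)} {(w , q)} v≈w → cong to (injective e λ x →
        trans (proj₂ (surjective e v p) x) (trans (v≈w x) (sym (proj₂ (surjective e w q) x))))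
    ; from-cong = λ { refl _ → refl }
    ; inverse   = (λ {i} {(w , p)} w≈ → trans
          (cong to (injective e λ x → trans (proj₂ (surjective e w p) x) (w≈ x))) (strictlyInverseˡ i))
        , λ { {(w , p)} refl x → trans
          (cong (λ y → perm e y ⟨$⟩ʳ x) (strictlyInverseʳ _)) (proj₂ (surjective e w p) x) }
    }
    where open Inverse (Index↔Fin e)

  enumeration-∅ : (∀ w → ¬ P w) → Enumeration P 0
  enumeration-∅ empty = record
    { Index      = Fin 0
    ; Index↔Fin  = ↔-id _
    ; perm       = λ ()
    ; satisfies  = λ ()
    ; injective  = λ {}
    ; surjective = λ w p → contradiction p (empty w)
    }

  module _ {Q : Pred (Permutation′ n) 0ℓ} where

    enumeration-⇔ : ∀ {c} → (∀ w → P w → Q w) → (∀ w → Q w → P w) → Enumeration P c → Enumeration Q c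
    enumeration-⇔ P⇒Q Q⇒P e = record
      { Enumeration e using (Index; Index↔Fin; perm; injective)
      ; satisfies  = λ x → P⇒Q _ (satisfies e x)
      ; surjective = λ w q → surjective e w (Q⇒P w q)
      }

    enumeration-⊎ : ∀ {a b} → (∀ v w → P v → Q w → ¬ v ≈ w) →
                    Enumeration P a → Enumeration Q b → Enumeration (λ w → P w ⊎ Q w) (a + b)
    enumeration-⊎ disjoint e f = record
      { Index      = Index e ⊎ Index f
      ; Index↔Fin  = ↔-sym Fin.+↔⊎ ↔-∘ (Index↔Fin e ⊎-↔ Index↔Fin f)
      ; perm       = [ perm e , perm f ]
      ; satisfies  = λ { (inj₁ x) → inj₁ (satisfies e x) ; (inj₂ y) → inj₂ (satisfies f y) }
      ; injective  = λ
          { {inj₁ x} {inj₁ y} eq → cong inj₁ (injective e eq)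
          ; {inj₁ x} {inj₂ y} eq → contradiction eq (disjoint _ _ (satisfies e x) (satisfies f y))
          ; {inj₂ x} {inj₁ y} eq → contradiction (sym ∘ eq) (disjoint _ _ (satisfies e y) (satisfies f x))
          ; {inj₂ x} {inj₂ y} eq → cong inj₂ (injective f eq) }
      ; surjective = λ
          { w (inj₁ p) → let x , eq = surjective e w p in inj₁ x , eq
          ; w (inj₂ q) → let y , eq = surjective f w q in inj₂ y , eq }
      }

  -- Inserting the value j at position i inverts the removal of that letter, up to pointwise
  -- equality; hence the hypothesis that `P` respects it.
  enumeration-insert : ∀ {c} (i j : Fin (suc n)) → (∀ v w → v ≈ w → P v → P w) → Enumeration P c →
                       Enumeration (λ w → w ⟨$⟩ʳ i ≡ j × P (remove i w)) c
  enumeration-insert i j resp e = record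
    { Enumeration e using (Index; Index↔Fin)
    ; perm       = λ x → insert i j (perm e x)
    ; satisfies  = λ x → insert-at (perm e x) ,
        resp _ _ (λ y → sym (Perm.remove-insert i j (perm e x) y)) (satisfies e x)
    ; injective  = λ {x} {y} eq → injective e λ z → Fin.punchIn-injective j _ _
        (trans (sym (Perm.insert-punchIn i j (perm e x) z))
          (trans (eq (punchIn i z)) (Perm.insert-punchIn i j (perm e y) z)))
    ; surjective = λ w (wi≡j , p) → let x , eq = surjective e (remove i w) p in
        x , reinsert w wi≡j (perm e x) eq
    }
    where
    insert-at : (v : Permutation′ n) → insert i j v ⟨$⟩ʳ i ≡ j
    insert-at v with i ≟ i
    ... | yes _  = refl
    ... | no i≢i = contradiction refl i≢i
    reinsert : ∀ w → w ⟨$⟩ʳ i ≡ j → ∀ v → v ≈ remove i w → insert i j v ≈ w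
    reinsert w wi≡j v eq y with i ≟ y
    ... | yes refl = sym wi≡j
    ... | no i≢y   = begin
      punchIn j (v ⟨$⟩ʳ punchOut i≢y)                      ≡⟨ cong₂ punchIn (sym wi≡j) (eq _) ⟩
      punchIn (w ⟨$⟩ʳ i) (remove i w ⟨$⟩ʳ punchOut i≢y)    ≡⟨ Perm.punchIn-permute w i _ ⟨
      w ⟨$⟩ʳ punchIn i (punchOut i≢y)
        ≡⟨ cong (w ⟨$⟩ʳ_) (Fin.punchIn-punchOut i≢y) ⟩
      w ⟨$⟩ʳ y                                             ∎
      where open ≡-Reasoning

enumeration-S₀ : {P : Pred (Permutation′ 0) 0ℓ} → (∀ w → P w) → Enumeration P 1
enumeration-S₀ all = record
  { Index      = Fin 1
  ; Index↔Fin  = ↔-id _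
  ; perm       = λ _ → Perm.id
  ; satisfies  = λ _ → all Perm.id
  ; injective  = λ { {0F} {0F} _ → refl }
  ; surjective = λ w _ → 0F , λ ()
  }

-- Order under removal of a letter

punchIn-mono-< : (i : Fin (suc n)) {j k : Fin n} → j < k → punchIn i j < punchIn i k
punchIn-mono-< i {j} {k} j<k = ℕ.≰⇒> (ℕ.<⇒≱ j<k ∘ Fin.punchIn-cancel-≤ i k j)

punchIn-cancel-< : (i : Fin (suc n)) {j k : Fin n} → punchIn i j < punchIn i k → j < k
punchIn-cancel-< i {j} {k} lt = ℕ.≰⇒> (ℕ.<⇒≱ lt ∘ Fin.punchIn-mono-≤ i k j)

punchIn-below : (i : Fin (suc n)) {j : Fin n} → j < i → punchIn i j < i
punchIn-below (suc i) {zero}  _         = s≤s z≤n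
punchIn-below (suc i) {suc j} (s≤s j<i) = s≤s (punchIn-below i j<i)

punchIn-above : (i : Fin (suc n)) {j : Fin n} → toℕ i ≤ toℕ j → toℕ (punchIn i j) ≡ suc (toℕ j)
punchIn-above zero    _                 = refl
punchIn-above (suc i) {suc j} (s≤s i≤j) = cong suc (punchIn-above i i≤j)

module _ (i : Fin (suc n)) (w : Permutation′ (suc n)) where

  remove-mono-< : ∀ {x y} → (remove i w ⟨$⟩ʳ x) < (remove i w ⟨$⟩ʳ y) →
                  (w ⟨$⟩ʳ punchIn i x) < (w ⟨$⟩ʳ punchIn i y)
  remove-mono-< {x} {y} lt = subst₂ _<_
    (sym (Perm.punchIn-permute w i x)) (sym (Perm.punchIn-permute w i y))
    (punchIn-mono-< (w ⟨$⟩ʳ i) lt)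

  remove-cancel-< : ∀ {x y} → (w ⟨$⟩ʳ punchIn i x) < (w ⟨$⟩ʳ punchIn i y) →
                    (remove i w ⟨$⟩ʳ x) < (remove i w ⟨$⟩ʳ y)
  remove-cancel-< {x} {y} lt = punchIn-cancel-< (w ⟨$⟩ʳ i) (subst₂ _<_
    (Perm.punchIn-permute w i x) (Perm.punchIn-permute w i y) lt)

  Has321-remove : Has321 (remove i w) → Has321 w
  Has321-remove (a , b , c , a<b , b<c , ba , cb) =
    punchIn i a , punchIn i b , punchIn i c , punchIn-mono-< i a<b , punchIn-mono-< i b<c ,
    remove-mono-< ba , remove-mono-< cb

  Has3412-remove : Has3412 (remove i w) → Has3412 w
  Has3412-remove (a , b , c , d , a<b , b<c , c<d , cd , da , ab) =
    punchIn i a , punchIn i b , punchIn i c , punchIn i d ,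
    punchIn-mono-< i a<b , punchIn-mono-< i b<c , punchIn-mono-< i c<d ,
    remove-mono-< cd , remove-mono-< da , remove-mono-< ab

-- Catalan numbers

-- Equivalently, the values below k occur in increasing order: no inversion has both its values
-- below k.
IncreasingBelow : ℕ → Permutation′ n → Set
IncreasingBelow k w = ∀ {x y} → x < y → (w ⟨$⟩ʳ y) < (w ⟨$⟩ʳ x) → k ≤ toℕ (w ⟨$⟩ʳ x)

Sorted321 : ℕ → Permutation′ n → Set
Sorted321 k w = ¬ Has321 w × IncreasingBelow k w

Sorted321-resp : ∀ k (v w : Permutation′ n) → v ≈ w → Sorted321 k v → Sorted321 k w
Sorted321-resp k v w v≈w (avoids , inc) = avoids ∘ Has321-resp w v (sym ∘ v≈w) , λ {x} {y} x<y inv →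
  subst (λ z → k ≤ toℕ z) (v≈w x) (inc x<y (subst₂ _<_ (sym (v≈w y)) (sym (v≈w x)) inv))

-- By `avoids-321⇒` and `avoids-321⇐`, the second component says that w avoids 321, in the form left
-- after removing the first letter.
StartsAbove : ℕ → Permutation′ (suc n) → Set
StartsAbove k w = k ≤ toℕ (w ⟨$⟩ʳ 0F) × Sorted321 (toℕ (w ⟨$⟩ʳ 0F)) (remove 0F w)

module _ (w : Permutation′ (suc n)) where

  private
    w₀ = w ⟨$⟩ʳ 0F
    w′ = remove 0F w

  value-above : ∀ {x} → toℕ w₀ ≤ toℕ (w′ ⟨$⟩ʳ x) → toℕ (w ⟨$⟩ʳ suc x) ≡ suc (toℕ (w′ ⟨$⟩ʳ x))
  value-above {x} le = trans (cong toℕ (Perm.punchIn-permute w 0F x)) (punchIn-above w₀ le)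

  -- The first letter plays the 3 of a 321 exactly when some later inversion has both its values
  -- below it.
  avoids-321⇒ : ¬ Has321 w → Sorted321 (toℕ w₀) w′
  avoids-321⇒ avoids = avoids ∘ Has321-remove 0F w , inc
    where
    inc : IncreasingBelow (toℕ w₀) w′
    inc {x} {y} x<y inv with (w′ ⟨$⟩ʳ x) Fin.<? w₀
    ... | no ≮   = ℕ.≮⇒≥ ≮
    ... | yes lt = contradiction (0F , suc x , suc y , s≤s z≤n , s≤s x<y ,
        subst (_< w₀) (sym (Perm.punchIn-permute w 0F x)) (punchIn-below w₀ lt) ,
        remove-mono-< 0F w inv) avoids

  avoids-321⇐ : Sorted321 (toℕ w₀) w′ → ¬ Has321 w
  avoids-321⇐ (avoids , inc) (zero , suc y , suc z , _ , s≤s y<z , y< , zy) =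
    contradiction y< (ℕ.<-asym (ℕ.≤-trans (s≤s le) (ℕ.≤-reflexive (sym (value-above le)))))
    where le = inc y<z (remove-cancel-< 0F w zy)
  avoids-321⇐ (avoids , inc) (suc x , suc y , suc z , s≤s x<y , s≤s y<z , yx , zy) =
    avoids (x , y , z , x<y , y<z , remove-cancel-< 0F w yx , remove-cancel-< 0F w zy)
  avoids-321⇐ (avoids , inc) (_ , suc y , zero , _ , () , _)

  -- If w₀ ≠ 0, then w₀ precedes the smaller value 0, so w₀ is not below k.
  Sorted321-split : ∀ k → Sorted321 k w →
                    (w₀ ≡ 0F × Sorted321 (ℕ.pred k) w′) ⊎ StartsAbove (suc (ℕ.pred k)) w
  Sorted321-split k (avoids , inc) with w₀ ≟ 0F
  ... | yes w₀≡0 = inj₁ (w₀≡0 , proj₁ (avoids-321⇒ avoids) , inc′)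
    where
    inc′ : IncreasingBelow (ℕ.pred k) w′
    inc′ {x} x<y inv = ℕ.pred-mono-≤ (ℕ.≤-trans (inc (s≤s x<y) (remove-mono-< 0F w inv))
      (ℕ.≤-reflexive (value-above (subst (λ z → toℕ z ≤ toℕ (w′ ⟨$⟩ʳ x)) (sym w₀≡0) z≤n))))
  ... | no w₀≢0 = inj₂ (bound k k≤w₀ , avoids-321⇒ avoids)
    where
    0<w₀ : 0 ℕ.< toℕ w₀
    0<w₀ = ℕ.n≢0⇒n>0 (w₀≢0 ∘ toℕ-injective)
    k≤w₀ : k ≤ toℕ w₀
    k≤w₀ = inc {0F} {w ⟨$⟩ˡ 0F}
      (ℕ.n≢0⇒n>0 λ eq → w₀≢0 (trans (cong (w ⟨$⟩ʳ_) (toℕ-injective {j = w ⟨$⟩ˡ 0F} (sym eq))) (inverseʳ w)))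
      (subst (_< w₀) (sym (inverseʳ w)) 0<w₀)
    -- `suc (ℕ.pred k)` is the maximum of k and 1: the first value is nonzero as well as at least k.
    bound : ∀ k → k ≤ toℕ w₀ → suc (ℕ.pred k) ≤ toℕ w₀
    bound zero    _  = 0<w₀
    bound (suc k) le = le

  -- If w₀ = 0, the other values rise by one on reinsertion, and so does the threshold. Otherwise
  -- the larger value of every inversion is at least w₀, hence at least k.
  Sorted321-unsplit : ∀ k → (w₀ ≡ 0F × Sorted321 (ℕ.pred k) w′) ⊎ StartsAbove (suc (ℕ.pred k)) w →
                      Sorted321 k w
  Sorted321-unsplit k (inj₁ (w₀≡0 , avoids , inc)) = avoids-321⇐ (avoids , λ {x} _ _ → w₀≤ x) , inc′
    where
    w₀≤ : ∀ x → toℕ w₀ ≤ toℕ (w′ ⟨$⟩ʳ x)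
    w₀≤ x = subst (λ z → toℕ z ≤ toℕ (w′ ⟨$⟩ʳ x)) (sym w₀≡0) z≤n
    inc′ : IncreasingBelow k w
    inc′ {zero}  {y}     _         inv = contradiction (subst ((w ⟨$⟩ʳ y) <_) w₀≡0 inv) λ ()
    inc′ {suc x} {suc y} (s≤s x<y) inv = subst (k ≤_) (sym (value-above (w₀≤ x)))
      (ℕ.≤-trans (ℕ.m≤n+m∸n k 1) (s≤s (inc x<y (remove-cancel-< 0F w inv))))
  Sorted321-unsplit k (inj₂ (le , a)) = avoids-321⇐ a , inc′
    where
    k≤w₀ : k ≤ toℕ w₀
    k≤w₀ = ℕ.≤-trans (ℕ.m≤n+m∸n k 1) le
    inc′ : IncreasingBelow k w
    inc′ {zero}  _         _   = k≤w₀
    inc′ {suc x} {suc y} (s≤s x<y) inv =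
      let w₀≤ = proj₂ a x<y (remove-cancel-< 0F w inv)
      in subst (k ≤_) (sym (value-above w₀≤)) (ℕ.≤-trans k≤w₀ (ℕ.m≤n⇒m≤1+n w₀≤))

-- With n = k + d, ballot k d counts Sorted321 k in 𝔖ₙ and ballot⁺ k d counts StartsAbove (k + 1)
-- in 𝔖ₙ₊₁; removing the first letter gives the recursion.
ballot : ℕ → ℕ → ℕ
ballot⁺ : ℕ → ℕ → ℕ
ballot zero    zero    = 1
ballot zero    (suc d) = ballot zero d + ballot⁺ zero d
ballot (suc k) d       = ballot k d + ballot⁺ k d
ballot⁺ k zero    = 0
ballot⁺ k (suc d) = ballot (suc k) d + ballot⁺ (suc k) d

enumeration-Sorted321 : ∀ n k d → k + d ≡ n → Enumeration {n} (Sorted321 k) (ballot k d)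
enumeration-StartsAbove : ∀ n k d → k + d ≡ n → Enumeration {suc n} (StartsAbove (suc k)) (ballot⁺ k d)

Sorted321-disjoint : ∀ {k l} (v w : Permutation′ (suc n)) →
                     v ⟨$⟩ʳ 0F ≡ 0F × Sorted321 k (remove 0F v) → StartsAbove (suc l) w → ¬ v ≈ w
Sorted321-disjoint v w (v₀≡0 , _) (l<w₀ , _) v≈w =
  contradiction (subst (λ z → _ ≤ toℕ z) (trans (sym (v≈w 0F)) v₀≡0) l<w₀) λ ()

enumeration-Sorted321 zero zero zero _ = enumeration-S₀ λ w → (λ { (() , _) }) , λ { {()} }
enumeration-Sorted321 (suc n) zero (suc d) eq =
  enumeration-⇔ (λ w → Sorted321-unsplit w 0) (λ w → Sorted321-split w 0)
    (enumeration-⊎ Sorted321-disjoint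
      (enumeration-insert 0F 0F (Sorted321-resp 0)
        (enumeration-Sorted321 n 0 d (ℕ.suc-injective eq)))
      (enumeration-StartsAbove n 0 d (ℕ.suc-injective eq)))
enumeration-Sorted321 (suc n) (suc k) d eq =
  enumeration-⇔ (λ w → Sorted321-unsplit w (suc k)) (λ w → Sorted321-split w (suc k))
    (enumeration-⊎ Sorted321-disjoint
      (enumeration-insert 0F 0F (Sorted321-resp k)
        (enumeration-Sorted321 n k d (ℕ.suc-injective eq)))
      (enumeration-StartsAbove n k d (ℕ.suc-injective eq)))

-- Here k = n is the largest value in this group, so no first value exceeds it.
enumeration-StartsAbove n k zero eq = enumeration-∅ λ w (k<w₀ , _) →
  ℕ.<⇒≱ k<w₀ (ℕ.≤-trans (ℕ.≤-pred (toℕ<n (w ⟨$⟩ʳ 0F)))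
    (ℕ.≤-reflexive (trans (sym eq) (ℕ.+-identityʳ k))))
-- The first value either equals k + 1 and is removed, or is at least k + 2.
enumeration-StartsAbove n k (suc d) eq = enumeration-⇔ to from
  (enumeration-⊎ disjoint (enumeration-insert 0F k+1 (Sorted321-resp (suc k))
      (enumeration-Sorted321 n (suc k) d eq′))
    (enumeration-StartsAbove n (suc k) d eq′))
  where
  eq′ : suc k + d ≡ n
  eq′ = trans (sym (ℕ.+-suc k d)) eq
  k<n : suc (suc k) ≤ suc n
  k<n = s≤s (subst (suc k ≤_) eq′ (ℕ.m≤m+n (suc k) d))
  k+1 : Fin (suc n)
  k+1 = fromℕ< k<n
  toℕ-k+1 : toℕ k+1 ≡ suc k
  toℕ-k+1 = Fin.toℕ-fromℕ< k<n
  to : ∀ w → (w ⟨$⟩ʳ 0F ≡ k+1 × Sorted321 (suc k) (remove 0F w)) ⊎ StartsAbove (suc (suc k)) w →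
       StartsAbove (suc k) w
  to w (inj₁ (w₀≡ , a)) =
    ℕ.≤-reflexive (sym w₀≡k+1) , subst (λ m → Sorted321 m (remove 0F w)) (sym w₀≡k+1) a
    where w₀≡k+1 = trans (cong toℕ w₀≡) toℕ-k+1
  to w (inj₂ (lt , a)) = ℕ.<⇒≤ lt , a
  from : ∀ w → StartsAbove (suc k) w →
         (w ⟨$⟩ʳ 0F ≡ k+1 × Sorted321 (suc k) (remove 0F w)) ⊎ StartsAbove (suc (suc k)) w
  from w (le , a) with ℕ.m≤n⇒m<n∨m≡n le
  ... | inj₁ lt = inj₂ (lt , a)
  ... | inj₂ k+1≡w₀ = inj₁ (toℕ-injective (trans (sym k+1≡w₀) (sym toℕ-k+1)) ,
                           subst (λ m → Sorted321 m (remove 0F w)) (sym k+1≡w₀) a)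
  disjoint : ∀ v w → v ⟨$⟩ʳ 0F ≡ k+1 × Sorted321 (suc k) (remove 0F v) →
             StartsAbove (suc (suc k)) w → ¬ v ≈ w
  disjoint v w (v₀≡ , _) (lt , _) v≈w =
    ℕ.<-irrefl (sym (trans (cong toℕ (trans (sym (v≈w 0F)) v₀≡)) toℕ-k+1)) lt

-- The absorption identity, with upper index written k + m to avoid subtraction; it follows by
-- induction through Pascal's rule.
C-absorb : ∀ k m → suc k * ((k + m) C suc k) ≡ m * ((k + m) C k)
C-absorb k zero = trans (cong (suc k *_) (k>n⇒nCk≡0 (s≤s (ℕ.≤-reflexive (ℕ.+-identityʳ k)))))
                    (ℕ.*-zeroʳ (suc k))
C-absorb zero (suc m) =
  trans (ℕ.*-identityˡ (suc m C 1)) (trans (nC1≡n (suc m)) (sym (ℕ.*-identityʳ (suc m))))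
C-absorb (suc k) (suc m) = begin
  suc (suc k) * (suc N C suc (suc k))
    ≡⟨ cong (suc (suc k) *_) (nCk+nC[k+1]≡[n+1]C[k+1] N (suc k)) ⟨
  suc (suc k) * (N C suc k + N C suc (suc k))
    ≡⟨ ℕ.*-distribˡ-+ (suc (suc k)) (N C suc k) _ ⟩
  suc (suc k) * (N C suc k) + suc (suc k) * (N C suc (suc k))
    ≡⟨ cong (suc (suc k) * (N C suc k) +_)
        (subst (λ M → suc (suc k) * (M C suc (suc k)) ≡ m * (M C suc k)) (sym (ℕ.+-suc k m)) (C-absorb (suc k) m)) ⟩
  suc (suc k) * (N C suc k) + m * (N C suc k)
    ≡⟨ regroup (suc k) m (N C suc k) ⟩
  suc k * (N C suc k) + suc m * (N C suc k)
    ≡⟨ cong (_+ suc m * (N C suc k)) (C-absorb k (suc m)) ⟩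
  suc m * (N C k) + suc m * (N C suc k)
    ≡⟨ ℕ.*-distribˡ-+ (suc m) (N C k) _ ⟨
  suc m * (N C k + N C suc k)
    ≡⟨ cong (suc m *_) (nCk+nC[k+1]≡[n+1]C[k+1] N k) ⟩
  suc m * (suc N C suc k) ∎
  where
  open ≡-Reasoning
  N = k + suc m
  regroup : ∀ a m c → suc a * c + m * c ≡ a * c + suc m * c
  regroup = solve-∀

ballot-0 : ∀ k → ballot k 0 ≡ 1
ballot-0 zero    = refl
ballot-0 (suc k) = trans (ℕ.+-identityʳ (ballot k 0)) (ballot-0 k)

-- The classical formula ballot k d = C(k + 2d, d) − C(k + 2d, d − 1).
ballot-formula : ∀ k d m → m ≡ 2 + k + (d + d) → ballot k (suc d) + m C d ≡ m C suc d
ballot-formula zero zero m refl = refl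
-- `ballot 0 (2 + d)` and `ballot 1 (1 + d)` unfold to the same sum.
ballot-formula zero (suc d) (suc m) eq = begin
  ballot 1 (suc d) + suc m C suc d
    ≡⟨ cong (ballot 1 (suc d) +_) (nCk+nC[k+1]≡[n+1]C[k+1] m d) ⟨
  ballot 1 (suc d) + (m C d + m C suc d)          ≡⟨ ℕ.+-assoc (ballot 1 (suc d)) _ _ ⟨
  ballot 1 (suc d) + m C d + m C suc d            ≡⟨ cong (_+ m C suc d) (ballot-formula 1 d m m≡) ⟩
  m C suc d + m C suc d                      ≡⟨ cong (m C suc d +_) middle ⟩
  m C suc d + m C suc (suc d)                ≡⟨ nCk+nC[k+1]≡[n+1]C[k+1] m (suc d) ⟩
  suc m C suc (suc d)                        ∎
  where
  open ≡-Reasoning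
  m≡ : m ≡ 3 + (d + d)
  m≡ = ℕ.suc-injective (trans eq (cong (3 +_) (ℕ.+-suc d d)))
  m≡′ : m ≡ suc d + suc (suc d)
  m≡′ = trans m≡ (cong suc (sym (trans (ℕ.+-suc d (suc d)) (cong suc (ℕ.+-suc d d)))))
  -- The upper index m = 2d + 3 is odd, so its two middle binomial coefficients agree.
  middle : m C suc d ≡ m C suc (suc d)
  middle = trans (nCk≡nC[n∸k] (subst (suc d ≤_) (sym m≡′) (ℕ.m≤m+n (suc d) _)))
             (cong (m C_) (trans (cong (_∸ suc d) m≡′) (ℕ.m+n∸m≡n (suc d) (suc (suc d)))))
ballot-formula (suc k) zero (suc m) eq = begin
  ballot k 1 + (ballot (suc k) 0 + 0) + 1
    ≡⟨ cong (λ a → ballot k 1 + a + 1) (trans (ℕ.+-identityʳ _) (ballot-0 (suc k))) ⟩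
  ballot k 1 + 1 + 1                 ≡⟨ cong (_+ 1) (ballot-formula k 0 m (ℕ.suc-injective eq)) ⟩
  m C 1 + 1                     ≡⟨ ℕ.+-comm (m C 1) 1 ⟩
  m C 0 + m C 1                 ≡⟨ nCk+nC[k+1]≡[n+1]C[k+1] m 0 ⟩
  suc m C 1                     ∎
  where open ≡-Reasoning
-- The recursion unfolds to `ballot k (2 + d) + ballot (2 + k) (1 + d)`, and both terms belong to
-- the same m.
ballot-formula (suc k) (suc d) (suc m) eq = begin
  ballot k (2 + d) + ballot (2 + k) (suc d) + suc m C suc d
    ≡⟨ cong (ballot k (2 + d) + ballot (2 + k) (suc d) +_) (nCk+nC[k+1]≡[n+1]C[k+1] m d) ⟨
  ballot k (2 + d) + ballot (2 + k) (suc d) + (m C d + m C suc d)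
    ≡⟨ regroup (ballot k (2 + d)) (ballot (2 + k) (suc d)) (m C d) (m C suc d) ⟩
  ballot (2 + k) (suc d) + m C d + (ballot k (2 + d) + m C suc d)
    ≡⟨ cong₂ _+_ (ballot-formula (2 + k) d m (trans m≡ (regroup′ k d))) (ballot-formula k (suc d) m m≡) ⟩
  m C suc d + m C suc (suc d)
    ≡⟨ nCk+nC[k+1]≡[n+1]C[k+1] m (suc d) ⟩
  suc m C suc (suc d) ∎
  where
  open ≡-Reasoning
  m≡ : m ≡ 2 + k + (suc d + suc d)
  m≡ = ℕ.suc-injective eq
  regroup : ∀ a b c e → a + b + (c + e) ≡ b + c + (a + e)
  regroup = solve-∀
  regroup′ : ∀ k d → 2 + k + (suc d + suc d) ≡ 2 + (2 + k) + (d + d)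
  regroup′ = solve-∀

-- With N = 2d + 2, absorption gives (d + 1) C(N, d + 1) = (d + 2) C(N, d). Hence d + 2 times the
-- difference C(N, d + 1) - C(N, d) is C(N, d + 1).
ballot≡catalan : ∀ d → ballot 0 (suc d) ≡ catalan (suc d)
ballot≡catalan d = ℕ.*-cancelʳ-≡ _ _ (2 + d) (trans (ℕ.+-cancelʳ-≡ (suc d * c₁) _ _ (begin
  ballot 0 (suc d) * (2 + d) + suc d * c₁        ≡⟨ cong (ballot 0 (suc d) * (2 + d) +_) absorb ⟩
  ballot 0 (suc d) * (2 + d) + (2 + d) * c₀      ≡⟨ regroup (ballot 0 (suc d)) (2 + d) c₀ ⟩
  (2 + d) * (ballot 0 (suc d) + c₀)              ≡⟨ cong ((2 + d) *_) (ballot-formula 0 d N N≡) ⟩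
  c₁ + suc d * c₁                           ∎)) (sym (catalan-exact (suc d))))
  where
  open ≡-Reasoning
  N = 2 * suc d
  c₀ = N C d
  c₁ = N C suc d
  N≡ : N ≡ 2 + (d + d)
  N≡ = trans (cong (suc d +_) (ℕ.+-identityʳ (suc d))) (cong suc (ℕ.+-suc d d))
  absorb : suc d * c₁ ≡ (2 + d) * c₀
  absorb = subst (λ M → suc d * (M C suc d) ≡ (2 + d) * (M C d))
    (sym (trans N≡ (sym (trans (ℕ.+-suc d (suc d)) (cong suc (ℕ.+-suc d d))))))
    (C-absorb d (2 + d))
  regroup : ∀ a b c → a * b + b * c ≡ b * (a + c)
  regroup = solve-∀

-- Fibonacci numbers

AvoidsBoth : Permutation′ n → Set
AvoidsBoth w = ¬ Has321 w × ¬ Has3412 w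

AvoidsBoth-resp : (v w : Permutation′ n) → v ≈ w → AvoidsBoth v → AvoidsBoth w
AvoidsBoth-resp v w v≈w (avoids₁ , avoids₂) =
  avoids₁ ∘ Has321-resp w v (sym ∘ v≈w) , avoids₂ ∘ Has3412-resp w v (sym ∘ v≈w)

Inverted : Permutation′ n → Fin n → Fin n → Set
Inverted w i a = (i < a × (w ⟨$⟩ʳ a) < (w ⟨$⟩ʳ i)) ⊎ (a < i × (w ⟨$⟩ʳ i) < (w ⟨$⟩ʳ a))

module _ (i : Fin (suc n)) (w : Permutation′ (suc n)) where

  AvoidsBoth-remove⇒ : AvoidsBoth w → AvoidsBoth (remove i w)
  AvoidsBoth-remove⇒ (avoids₁ , avoids₂) = avoids₁ ∘ Has321-remove i w , avoids₂ ∘ Has3412-remove i w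

  punchOut-mono-< : ∀ {x y} (i≢x : i ≢ x) (i≢y : i ≢ y) → x < y → punchOut i≢x < punchOut i≢y
  punchOut-mono-< i≢x i≢y x<y = punchIn-cancel-< i
    (subst₂ _<_ (sym (Fin.punchIn-punchOut i≢x)) (sym (Fin.punchIn-punchOut i≢y)) x<y)

  remove-punchOut-< : ∀ {x y} (i≢x : i ≢ x) (i≢y : i ≢ y) → (w ⟨$⟩ʳ x) < (w ⟨$⟩ʳ y) →
                      (remove i w ⟨$⟩ʳ punchOut i≢x) < (remove i w ⟨$⟩ʳ punchOut i≢y)
  remove-punchOut-< i≢x i≢y lt = remove-cancel-< i w
    (subst₂ (λ x y → (w ⟨$⟩ʳ x) < (w ⟨$⟩ʳ y))
      (sym (Fin.punchIn-punchOut i≢x)) (sym (Fin.punchIn-punchOut i≢y)) lt)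

  -- Every letter of 321 and of 3412 takes part in two inversions.
  AvoidsBoth-remove⇐ : (∀ {a b} → Inverted w i a → Inverted w i b → a ≡ b) →
                       AvoidsBoth (remove i w) → AvoidsBoth w
  AvoidsBoth-remove⇐ unique (avoids₁ , avoids₂) =
    (λ (a , b , c , a<b , b<c , ba , cb) →
      let i≢a = λ { refl → <⇒≢ b<c (unique (inj₁ (a<b , ba)) (inj₁ (ℕ.<-trans a<b b<c , ℕ.<-trans cb ba))) }
          i≢b = λ { refl → <⇒≢ (ℕ.<-trans a<b b<c) (unique (inj₂ (a<b , ba)) (inj₁ (b<c , cb))) }
          i≢c = λ { refl → <⇒≢ a<b (unique (inj₂ (ℕ.<-trans a<b b<c , ℕ.<-trans cb ba)) (inj₂ (b<c , cb))) }
      in avoids₁ (punchOut i≢a , punchOut i≢b , punchOut i≢c ,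
           punchOut-mono-< i≢a i≢b a<b , punchOut-mono-< i≢b i≢c b<c ,
           remove-punchOut-< i≢b i≢a ba , remove-punchOut-< i≢c i≢b cb)) ,
    (λ (a , b , c , d , a<b , b<c , c<d , cd , da , ab) →
      let a<c = ℕ.<-trans a<b b<c
          b<d = ℕ.<-trans b<c c<d
          a<d = ℕ.<-trans a<c c<d
          ca = ℕ.<-trans cd da
          db = ℕ.<-trans da ab
          cb = ℕ.<-trans cd db
          i≢a = λ { refl → <⇒≢ c<d (unique (inj₁ (a<c , ca)) (inj₁ (a<d , da))) }
          i≢b = λ { refl → <⇒≢ c<d (unique (inj₁ (b<c , cb)) (inj₁ (b<d , db))) }
          i≢c = λ { refl → <⇒≢ a<b (unique (inj₂ (a<c , ca)) (inj₂ (b<c , cb))) }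
          i≢d = λ { refl → <⇒≢ a<b (unique (inj₂ (a<d , da)) (inj₂ (b<d , db))) }
      in avoids₂ (punchOut i≢a , punchOut i≢b , punchOut i≢c , punchOut i≢d ,
           punchOut-mono-< i≢a i≢b a<b , punchOut-mono-< i≢b i≢c b<c , punchOut-mono-< i≢c i≢d c<d ,
           remove-punchOut-< i≢c i≢d cd , remove-punchOut-< i≢d i≢a da , remove-punchOut-< i≢a i≢b ab))

-- The removed letter is in no inversion. In the next two lemmas its only possible partner is the
-- value 0, respectively the position 0.
AvoidsBoth₀ : (w : Permutation′ (suc n)) → w ⟨$⟩ʳ 0F ≡ 0F → AvoidsBoth (remove 0F w) → AvoidsBoth w
AvoidsBoth₀ w w₀≡0 = AvoidsBoth-remove⇐ 0F w λ {a} → λ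
  { (inj₁ (_ , lt)) _ → contradiction (subst ((w ⟨$⟩ʳ a) <_) w₀≡0 lt) λ ()
  ; (inj₂ (() , _)) }

AvoidsBoth₀₁ : (w : Permutation′ (2 + n)) → w ⟨$⟩ʳ 0F ≡ 1F → AvoidsBoth (remove 0F w) → AvoidsBoth w
AvoidsBoth₀₁ w w₀≡1 = AvoidsBoth-remove⇐ 0F w λ where
    (inj₁ (_ , lt)) (inj₁ (_ , lt′)) → ⟨$⟩ʳ-injective w (trans (least lt) (sym (least lt′)))
  where
  least : ∀ {a} → (w ⟨$⟩ʳ a) < (w ⟨$⟩ʳ 0F) → w ⟨$⟩ʳ a ≡ 0F
  least {a} lt = toℕ-injective (ℕ.n<1⇒n≡0 (subst ((w ⟨$⟩ʳ a) <_) w₀≡1 lt))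

AvoidsBoth₁₀ : (w : Permutation′ (2 + n)) → w ⟨$⟩ʳ 1F ≡ 0F → AvoidsBoth (remove 1F w) → AvoidsBoth w
AvoidsBoth₁₀ w w₁≡0 = AvoidsBoth-remove⇐ 1F w unique
  where
  not-below : ∀ {a} → ¬ (w ⟨$⟩ʳ a) < (w ⟨$⟩ʳ 1F)
  not-below {a} lt = contradiction (subst ((w ⟨$⟩ʳ a) <_) w₁≡0 lt) λ ()
  unique : ∀ {a b} → Inverted w 1F a → Inverted w 1F b → a ≡ b
  unique (inj₁ (_ , lt))  _               = contradiction lt not-below
  unique (inj₂ _)         (inj₁ (_ , lt)) = contradiction lt not-below
  unique (inj₂ (a<1 , _)) (inj₂ (b<1 , _)) =
    toℕ-injective (trans (ℕ.n<1⇒n≡0 a<1) (sym (ℕ.n<1⇒n≡0 b<1)))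

Moves0 : Permutation′ (suc n) → Set
Moves0 w = w ⟨$⟩ʳ 0F ≢ 0F × AvoidsBoth w

Moves0-resp : (v w : Permutation′ (suc n)) → v ≈ w → Moves0 v → Moves0 w
Moves0-resp v w v≈w (v₀≢0 , avoids) = v₀≢0 ∘ trans (v≈w 0F) , AvoidsBoth-resp v w v≈w avoids

-- Thus w(0) = 1 exactly when the remaining permutation fixes 0, which keeps the two cases of
-- `Moves0-split` apart.
value-after-remove₁ : (w : Permutation′ (2 + n)) → w ⟨$⟩ʳ 1F ≡ 0F →
                      w ⟨$⟩ʳ 0F ≡ suc (remove 1F w ⟨$⟩ʳ 0F)
value-after-remove₁ w w₁≡0 = trans (Perm.punchIn-permute w 1F 0F)
  (cong (λ j → punchIn j (remove 1F w ⟨$⟩ʳ 0F)) w₁≡0)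

Moves0-split : (w : Permutation′ (2 + n)) → Moves0 w →
  (w ⟨$⟩ʳ 0F ≡ 1F × AvoidsBoth (remove 0F w)) ⊎ (w ⟨$⟩ʳ 1F ≡ 0F × Moves0 (remove 1F w))
Moves0-split w (w₀≢0 , avoids) with (w ⟨$⟩ʳ 0F) ≟ 1F
... | yes w₀≡1 = inj₁ (w₀≡1 , AvoidsBoth-remove⇒ 0F w avoids)
-- The first moved point is 0, with nothing below it to be fixed.
... | no w₀≢1 with first-moved-adjacent w w₀≢0 (λ ()) {1F} refl (proj₁ avoids) (proj₂ avoids)
...   | inj₁ w₀≡1 = contradiction w₀≡1 w₀≢1
...   | inj₂ w₁≡0 = inj₂ (w₁≡0 ,
        (λ v₀≡0 → w₀≢1 (trans (value-after-remove₁ w w₁≡0) (cong suc v₀≡0))) ,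
        AvoidsBoth-remove⇒ 1F w avoids)

Moves0-unsplit : (w : Permutation′ (2 + n)) →
  (w ⟨$⟩ʳ 0F ≡ 1F × AvoidsBoth (remove 0F w)) ⊎ (w ⟨$⟩ʳ 1F ≡ 0F × Moves0 (remove 1F w)) → Moves0 w
Moves0-unsplit w (inj₁ (w₀≡1 , avoids)) =
  (λ w₀≡0 → contradiction (trans (sym w₀≡0) w₀≡1) λ ()) , AvoidsBoth₀₁ w w₀≡1 avoids
Moves0-unsplit w (inj₂ (w₁≡0 , _ , avoids)) =
  (λ w₀≡0 → contradiction (trans (sym w₀≡0) (value-after-remove₁ w w₁≡0)) λ ()) ,
  AvoidsBoth₁₀ w w₁≡0 avoids

-- The two counts alternate along the Fibonacci sequence: removing a letter gives F(2n+2) = F(2n+1)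
-- + F(2n) for `Moves0`, and then F(2n+3) = F(2n+2) + F(2n+1) for `AvoidsBoth`.
enumeration-AvoidsBoth : ∀ n → Enumeration {suc n} AvoidsBoth (fibonacci (suc (2 * n)))
enumeration-Moves0 : ∀ n → Enumeration {suc n} Moves0 (fibonacci (2 * n))

fixes-or-moves : ∀ {n a b} → Enumeration {n} AvoidsBoth a → Enumeration {suc n} Moves0 b →
                 Enumeration {suc n} AvoidsBoth (b + a)
fixes-or-moves e f = enumeration-⇔
  (λ { w (inj₁ (_ , avoids)) → avoids ; w (inj₂ (w₀≡0 , avoids)) → AvoidsBoth₀ w w₀≡0 avoids })
  split
  (enumeration-⊎ (λ { v w (v₀≢0 , _) (w₀≡0 , _) v≈w → v₀≢0 (trans (v≈w 0F) w₀≡0) })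
    f (enumeration-insert 0F 0F AvoidsBoth-resp e))
  where
  split : ∀ w → AvoidsBoth w → Moves0 w ⊎ (w ⟨$⟩ʳ 0F ≡ 0F × AvoidsBoth (remove 0F w))
  split w avoids with (w ⟨$⟩ʳ 0F) ≟ 0F
  ... | yes w₀≡0 = inj₂ (w₀≡0 , AvoidsBoth-remove⇒ 0F w avoids)
  ... | no w₀≢0  = inj₁ (w₀≢0 , avoids)

enumeration-AvoidsBoth zero = fixes-or-moves
  (enumeration-S₀ λ w → (λ { (() , _) }) , λ { (() , _) }) (enumeration-Moves0 zero)
enumeration-AvoidsBoth (suc n) =
  -- `fibonacci` unfolds only once the index is written as 2 + 2n.
  subst (Enumeration {2 + n} AvoidsBoth ∘ fibonacci ∘ suc) (sym (ℕ.*-suc 2 n))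
  (fixes-or-moves (enumeration-AvoidsBoth n)
    (subst (Enumeration {2 + n} Moves0 ∘ fibonacci) (ℕ.*-suc 2 n) (enumeration-Moves0 (suc n))))

enumeration-Moves0 zero = enumeration-∅ λ w (w₀≢0 , _) → w₀≢0 (only (w ⟨$⟩ʳ 0F))
  where
  only : (x : Fin 1) → x ≡ 0F
  only 0F = refl
enumeration-Moves0 (suc n) = subst (Enumeration {2 + n} Moves0 ∘ fibonacci) (sym (ℕ.*-suc 2 n))
  (enumeration-⇔ Moves0-unsplit Moves0-split
    (enumeration-⊎ disjoint
      (enumeration-insert 0F 1F AvoidsBoth-resp (enumeration-AvoidsBoth n))
      (enumeration-insert 1F 0F Moves0-resp (enumeration-Moves0 n))))
  where
  disjoint : (v w : Permutation′ (2 + n)) → v ⟨$⟩ʳ 0F ≡ 1F × AvoidsBoth (remove 0F v) →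
             w ⟨$⟩ʳ 1F ≡ 0F × Moves0 (remove 1F w) → ¬ v ≈ w
  disjoint v w (v₀≡1 , _) (w₁≡0 , u₀≢0 , _) v≈w = u₀≢0 (Fin.suc-injective
    (trans (sym (value-after-remove₁ w w₁≡0)) (trans (sym (v≈w 0F)) v₀≡1)))

theorem1p4 : (n : ℕ) → 1 ≤ n →
    ((w : Permutation′ n) → (dp w ≡ ℓS w) ⇔ Avoids w p321) ×
    ((w : Permutation′ n) → (ℓT w ≡ dp w) ⇔ (Avoids w p321 × Avoids w p3412)) ×
    HasCardinality (PermutationsWith (λ (w : Permutation′ n) → dp w ≡ ℓS w)) (catalan n) ×
    HasCardinality (PermutationsWith (λ (w : Permutation′ n) → ℓT w ≡ dp w)) (fibonacci (2 * n ∸ 1))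
theorem1p4 (suc m) _ =
  (λ w → mk⇔
    (λ eq → to (dp≡ℓS⇔ w) eq ∘ to (contains-321⇔ w))
    (λ avoids → from (dp≡ℓS⇔ w) (avoids ∘ from (contains-321⇔ w)))) ,
  (λ w → mk⇔
    (λ eq → proj₁ (to (ℓT≡dp⇔ w) eq) ∘ to (contains-321⇔ w) ,
            proj₂ (to (ℓT≡dp⇔ w) eq) ∘ to (contains-3412⇔ w))
    (λ (avoids₁ , avoids₂) → from (ℓT≡dp⇔ w)
      (avoids₁ ∘ from (contains-321⇔ w) , avoids₂ ∘ from (contains-3412⇔ w)))) ,
  subst (HasCardinality (PermutationsWith (λ (w : Permutation′ (suc m)) → dp w ≡ ℓS w))) (ballot≡catalan m)
    (enumeration⇒cardinality
    -- At threshold 0 the condition on inversions is vacuous, so `Sorted321 0` is avoidance of 321.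
    (enumeration-⇔ (λ w (avoids , _) → from (dp≡ℓS⇔ w) avoids)
      (λ w eq → to (dp≡ℓS⇔ w) eq , λ {_ _} _ _ → z≤n) (enumeration-Sorted321 (suc m) 0 (suc m) refl))) ,
  -- The index `2 * suc m ∸ 1` is the predecessor of 2 + 2m, that is 2m + 1.
  subst (HasCardinality (PermutationsWith (λ (w : Permutation′ (suc m)) → ℓT w ≡ dp w)) ∘ fibonacci ∘ ℕ.pred)
    (sym (ℕ.*-suc 2 m)) (enumeration⇒cardinality
    (enumeration-⇔ (λ w → from (ℓT≡dp⇔ w)) (λ w → to (ℓT≡dp⇔ w)) (enumeration-AvoidsBoth m)))
  where open Equivalence
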